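{- For all integers $t\geq 2$ and $k\geq 1$, \[ \beta_B(K_t,k)=\binom{t}{2}^{ -k\binom{t}{2}}. \]
   Context: $K_t$ is the complete graph on $t$ vertices. For a finite set $X$, $\mathcal{C}(X,H)$ is the set of subgraphs of the complete graph on $X$ isomorphic to $H$. For a probability mass $\mu$ on $\binom{X}{2}$ and a subgraph $G$ of the complete graph on $X$, $\mu(G)=\prod_{e\in E(G)}\mu(e)$. For a graph $H$ without isolated vertices and a positive integer $k$, $\beta_B(\mu;H,k)=\sum_{H'\in\mathcal{C}(X,H)}\mu(H')^k$ and $\beta_B(H,k)=\sup\beta_B(\mu;H,k)$ over all finite sets $X$ and probability masses $\mu$ on $\binom{X}{2}$.
   Formalization: The probability masses μ take rational values only, and the supremum is the least rational upper bound over all finite sets X and rational-valued probability masses. -}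

module Defs where

open import Data.Nat as ℕ using (ℕ; zero; suc)
open import Data.Nat.Combinatorics using (_C_)
open import Data.Integer using (+_)
open import Data.Rational using (ℚ; 0ℚ; 1ℚ; _+_; _*_; _/_; _≤_)
open import Data.Fin using (Fin; toℕ)
open import Data.Fin.Subset using (Subset; ∣_∣; _∈_)
open import Data.Fin.Subset.Properties using (_∈?_)
open import Data.Bool using (Bool; true; false)
open import Data.Vec using (_∷_; [])
open import Data.List using (List; []; _∷_; map; filter; concatMap; foldr; _++_; allFin)
open import Data.Product using (_×_; _,_; proj₁; proj₂)
open import Relation.Nullary.Decidable using (_×-dec_)

sumℚ : List ℚ → ℚ
sumℚ = foldr _+_ 0ℚ

prodℚ : List ℚ → ℚ
prodℚ = foldr _*_ 1ℚ

powℚ : ℚ → ℕ → ℚ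
powℚ q zero    = 1ℚ
powℚ q (suc m) = q * powℚ q m

-- 1/m for m ≥ 1 (value 0 at m = 0, never used in the theorem since C(t,2) ≥ 1)
recip : ℕ → ℚ
recip zero    = 0ℚ
recip (suc m) = (+ 1) / suc m

-- The vertex set X is Fin n.  Edges of K_X: pairs (i , j) with i < j.
edges : (n : ℕ) → List (Fin n × Fin n)
edges n = filter (λ p → toℕ (proj₁ p) ℕ.<? toℕ (proj₂ p))
                 (concatMap (λ i → map (λ j → (i , j)) (allFin n)) (allFin n))

-- A mass function on edges: μ i j is the mass of the edge {i,j}, read for i < j.
Mass : ℕ → Set
Mass n = Fin n → Fin n → ℚ

IsProbMass : (n : ℕ) → Mass n → Set
IsProbMass n μ =
  ((i j : Fin n) → toℕ i ℕ.< toℕ j → 0ℚ ≤ μ i j) ×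
  (sumℚ (map (λ p → μ (proj₁ p) (proj₂ p)) (edges n)) ≡ 1ℚ)
  where open import Relation.Binary.PropositionalEquality using (_≡_)

subsets : (n : ℕ) → List (Subset n)
subsets zero    = [] ∷ []
subsets (suc n) = map (false ∷_) (subsets n) ++ map (true ∷_) (subsets n)

-- The copies of K_t in K_X: the complete graphs on the t-element vertex sets S ⊆ X.
copiesK : (n t : ℕ) → List (Subset n)
copiesK n t = filter (λ S → ∣ S ∣ ℕ.≟ t) (subsets n)

edgesOf : {n : ℕ} → Subset n → List (Fin n × Fin n)
edgesOf {n} S = filter (λ p → (proj₁ p ∈? S) ×-dec (proj₂ p ∈? S)) (edges n)

μOf : {n : ℕ} → Mass n → Subset n → ℚ
μOf μ S = prodℚ (map (λ p → μ (proj₁ p) (proj₂ p)) (edgesOf S))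

βB : (n : ℕ) → Mass n → (t k : ℕ) → ℚ
βB n μ t k = sumℚ (map (λ S → powℚ (μOf μ S) k) (copiesK n t))

IsUpperBound : (t k : ℕ) → ℚ → Set
IsUpperBound t k r = (n : ℕ) (μ : Mass n) → IsProbMass n μ → βB n μ t k ≤ r

IsSupβB : (t k : ℕ) → ℚ → Set
IsSupβB t k r = IsUpperBound t k r × ((s : ℚ) → IsUpperBound t k s → r ≤ s)

-- Since ∑ xᵏ ≤ (∑ x)ᵏ, only k = 1 matters.  Write t = s + 1 and m = C(t,2) = s t / 2, let d v be
-- the total mass at the vertex v, and for a t-set S = {v} ∪ T let y(v,T) be the product of the
-- masses of the edges from v to T.  Then μ(S) = ∏ y(v,S∖v)^½ over v ∈ S.  Two estimates combine:
-- for nonnegative f, the sum over s-sets T of ∏_T f^(t/2) is at most (∑ f / s)^m, and ∏_S d ≤ (2/t)^t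
-- because the degrees sum to 2.  By AM-GM over v ∈ S,
--     μ(S) ≤ (1/t) ∑_{v ∈ S} ((2/t) / d v)^(m-1) y(v,S∖v)^(t/2),
-- and summing over S, grouped by v, gives at most (1/t) (2/t)^(m-1) s^(-m) ∑ d = m^(-m).
-- As y^(t/2) need not be rational, it is replaced by a polynomial upper bound (majorant below) that
-- still satisfies the first estimate.

module Submission where

open import Defs
open import Data.Bool using (true; false; _∧_)
open import Data.Empty using (⊥-elim)
open import Data.Fin using (Fin; toℕ; zero; suc)
import Data.Fin.Properties as Finₚ
open import Data.Fin.Subset using (Subset; ∣_∣)
open import Data.Fin.Subset.Properties using (_∈?_)
import Data.Integer as ℤ
import Data.Integer.Properties as ℤₚ
open import Data.List using (List; []; _∷_; map; length; _++_; replicate; filter; concatMap; allFin)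
open import Data.List.Properties using (map-∘; map-cong; map-++; map-tabulate; length-map; length-++; length-replicate; length-tabulate; filter-++; filter-all; concatMap-map; concatMap-cong; map-concatMap)
open import Data.List.Membership.Propositional using (_∈_)
open import Data.List.Membership.Propositional.Properties using (∈-filter⁻)
open import Data.List.Relation.Unary.All as All using (All; []; _∷_)
import Data.List.Relation.Unary.All.Properties as Allₚ
open import Data.List.Relation.Unary.Any using (here; there)
open import Data.Nat as ℕ using (ℕ; zero; suc)
open import Data.Nat.Combinatorics using (_C_; nC1≡n; nCk+nC[k+1]≡[n+1]C[k+1])
import Data.Nat.Properties as ℕₚ
open import Data.Product using (_×_; _,_; proj₁; proj₂; map₂)
import Data.Rational.Unnormalised as ℚᵘ
import Data.Rational.Unnormalised.Properties as ℚᵘₚ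
open import Data.Sum using (inj₁; inj₂)
import Data.Vec as Vec
open import Function using (_∘_)
open import Level using (0ℓ)
open import Relation.Binary using (tri<; tri≈; tri>)
open import Relation.Binary.PropositionalEquality
open import Relation.Nullary using (Dec; yes; no; does; contradiction; ¬_)
open import Relation.Nullary.Decidable using (_×-dec_)
open import Relation.Unary using (Pred; Decidable)

-- The exponents are forced. Each edge of S lies in two of its stars, so the power t/2 makes the
-- geometric mean over the t vertices return μ(S) itself; a star bound of degree m in d v then needs
-- the coefficient (1 / d v)^(m-1), which leaves one factor d v for the degree sum to absorb. The
-- uniform mass on exactly t vertices attains the value: there every d v is 2/t, the coefficients
-- are 1, and both estimates and the AM-GM step are equalities. Hence no constant may be lost, and
-- the polynomial replacing y^(t/2) has to be sharp at constant f as well. That polynomial takes the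
-- full degree d v as a parameter, not only the part of it inside S: every T then shares the same
-- auxiliary values, and sums over T factor. No root is ever taken. Inequalities with fractional
-- exponents are stated between squares or higher powers and brought back by `^-cancel-≤`. Degree
-- zero, where 1 / d v makes no sense, is a separate case: a clique through such a vertex has weight
-- zero.

private variable
  A A′ : Set

-- Subsets are represented by sublists: picks lists the splittings of a list into one element and
-- the remaining ones, comb n its sublists of length n.
picks : List A → List (A × List A)
picks []       = []
picks (x ∷ xs) = (x , xs) ∷ map (map₂ (x ∷_)) (picks xs)

comb : ℕ → List A → List (List A)
comb zero    xs       = [] ∷ []
comb (suc n) []       = []
comb (suc n) (x ∷ xs) = comb (suc n) xs ++ map (x ∷_) (comb n xs)

pairs : List A → List (A × A)
pairs []       = []
pairs (x ∷ xs) = map (x ,_) xs ++ pairs xs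

length-picks : ∀ (xs : List A) → length (picks xs) ≡ length xs
length-picks []       = refl
length-picks (x ∷ xs) = cong suc (trans (length-map _ (picks xs)) (length-picks xs))

map-proj₁-picks : ∀ (xs : List A) → map proj₁ (picks xs) ≡ xs
map-proj₁-picks []       = refl
map-proj₁-picks (x ∷ xs) = cong (x ∷_) (trans (sym (map-∘ (picks xs))) (map-proj₁-picks xs))

picks-length : ∀ (xs : List A) {v T} → (v , T) ∈ picks xs → length xs ≡ suc (length T)
picks-length xs = All.lookup (go xs)
  where
  go : ∀ (xs : List A) → All (λ p → length xs ≡ suc (length (proj₂ p))) (picks xs)
  go []       = []
  go (x ∷ xs) = refl ∷ Allₚ.map⁺ (All.map (cong suc) (go xs))

comb-length : ∀ n (xs : List A) {T} → T ∈ comb n xs → length T ≡ n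
comb-length n xs = All.lookup (go n xs)
  where
  go : ∀ n (xs : List A) → All (λ T → length T ≡ n) (comb n xs)
  go zero    xs       = refl ∷ []
  go (suc n) []       = []
  go (suc n) (x ∷ xs) = Allₚ.++⁺ (go (suc n) xs) (Allₚ.map⁺ (All.map (cong suc) (go n xs)))

-- The number m = C(n+1,2), in a form that unfolds: `triangle (suc j)` is `suc (j + triangle j)` by
-- computation, so powers split off a factor and `recip` meets a successor.
triangle : ℕ → ℕ
triangle zero    = zero
triangle (suc n) = suc n ℕ.+ triangle n

C₂≡triangle : ∀ n → suc n C 2 ≡ triangle n
C₂≡triangle zero    = refl
C₂≡triangle (suc n) = trans (sym (nCk+nC[k+1]≡[n+1]C[k+1] (suc n) 1)) (cong₂ ℕ._+_ (nC1≡n (suc n)) (C₂≡triangle n))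

-- Filters, sublists and pairs of lists.

filter-map : ∀ {P : Pred A′ 0ℓ} {Q : Pred A 0ℓ} (P? : Decidable P) (Q? : Decidable Q) (h : A → A′) →
  (∀ x → does (P? (h x)) ≡ does (Q? x)) → ∀ xs → filter P? (map h xs) ≡ map h (filter Q? xs)
filter-map P? Q? h eq []       = refl
filter-map P? Q? h eq (x ∷ xs) rewrite eq x with does (Q? x)
... | true  = cong (h x ∷_) (filter-map P? Q? h eq xs)
... | false = filter-map P? Q? h eq xs

filter-false : ∀ {P : Pred A 0ℓ} (P? : Decidable P) (h : A′ → A) → (∀ x → does (P? (h x)) ≡ false) →
  ∀ xs → filter P? (map h xs) ≡ []
filter-false P? h eq []       = refl
filter-false P? h eq (x ∷ xs) rewrite eq x = filter-false P? h eq xs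

filter-concatMap : ∀ {P : Pred A′ 0ℓ} (P? : Decidable P) (h : A → List A′) xs →
  filter P? (concatMap h xs) ≡ concatMap (filter P? ∘ h) xs
filter-concatMap P? h []       = refl
filter-concatMap P? h (x ∷ xs) =
  trans (filter-++ P? (h x) (concatMap h xs)) (cong (filter P? (h x) ++_) (filter-concatMap P? h xs))

comb-map : ∀ (h : A → A′) n xs → comb n (map h xs) ≡ map (map h) (comb n xs)
comb-map h zero    xs       = refl
comb-map h (suc n) []       = refl
comb-map h (suc n) (x ∷ xs) = trans
  (cong₂ _++_ (comb-map h (suc n) xs)
    (trans (cong (map (h x ∷_)) (comb-map h n xs))
      (trans (sym (map-∘ (comb n xs))) (map-∘ (comb n xs)))))
  (sym (map-++ (map h) (comb (suc n) xs) (map (x ∷_) (comb n xs))))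

comb-> : ∀ n (xs : List A) → length xs ℕ.< n → comb n xs ≡ []
comb-> (suc n) []       _             = refl
comb-> (suc n) (x ∷ xs) (ℕ.s≤s len<n) = cong₂ (λ b c → b ++ map (x ∷_) c)
  (comb-> (suc n) xs (ℕₚ.m≤n⇒m≤1+n len<n)) (comb-> n xs len<n)

comb-length≡ : ∀ (xs : List A) → comb (length xs) xs ≡ xs ∷ []
comb-length≡ []       = refl
comb-length≡ (x ∷ xs) = cong₂ (λ b c → b ++ map (x ∷_) c) (comb-> (suc (length xs)) xs ℕₚ.≤-refl) (comb-length≡ xs)

pairs-map : ∀ (h : A → A′) xs → pairs (map h xs) ≡ map (λ e → h (proj₁ e) , h (proj₂ e)) (pairs xs)
pairs-map h []       = refl
pairs-map h (x ∷ xs) = trans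
  (cong₂ _++_ (trans (sym (map-∘ xs)) (map-∘ xs)) (pairs-map h xs))
  (sym (map-++ _ (map (x ,_) xs) (pairs xs)))

length-pairs : ∀ n (xs : List A) → length xs ≡ suc n → length (pairs xs) ≡ triangle n
length-pairs zero    (x ∷ [])         eq = refl
length-pairs (suc n) (x ∷ xs@(_ ∷ _)) eq = trans (length-++ (map (x ,_) xs))
  (cong₂ ℕ._+_ (trans (length-map (x ,_) xs) (ℕₚ.suc-injective eq)) (length-pairs n xs (ℕₚ.suc-injective eq)))

filter-pairs : ∀ {Q : Pred A 0ℓ} (Q? : Decidable Q) xs →
  filter (λ e → Q? (proj₁ e) ×-dec Q? (proj₂ e)) (pairs xs) ≡ pairs (filter Q? xs)
filter-pairs Q? []       = refl
filter-pairs Q? (x ∷ xs) = trans (filter-++ Q²? (map (x ,_) xs) (pairs xs)) (go (does (Q? x)) refl)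
  where
  Q²? : Decidable _
  Q²? e = Q? (proj₁ e) ×-dec Q? (proj₂ e)
  go : ∀ b → does (Q? x) ≡ b →
       filter Q²? (map (x ,_) xs) ++ filter Q²? (pairs xs) ≡ pairs (filter Q? (x ∷ xs))
  go true  eq rewrite eq = cong₂ _++_
    (filter-map Q²? Q? (x ,_) (λ y → cong (_∧ does (Q? y)) eq) xs) (filter-pairs Q? xs)
  go false eq rewrite eq = cong₂ _++_
    (filter-false Q²? (x ,_) (λ y → cong (_∧ does (Q? y)) eq) xs) (filter-pairs Q? xs)

-- Edges and copies of K_t as pairs and sublists of the vertex list.

allFin-suc : ∀ n → allFin (suc n) ≡ zero ∷ map suc (allFin n)
allFin-suc n = cong (zero ∷_) (sym (map-tabulate (λ i → i) suc))

-- Induction on n: row zero loses only its diagonal entry, and every later row loses its entry in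
-- column zero, so that what remains is the edge list on n vertices shifted by `suc`.
edges≡pairs : ∀ n → edges n ≡ pairs (allFin n)
edges≡pairs zero    = refl
edges≡pairs (suc n) = begin
  edges (suc n)
    ≡⟨ cong (λ K → filter <²? (concatMap (λ i → map (i ,_) K) K)) (allFin-suc n) ⟩
  filter <²? (row′ zero ++ concatMap row′ (map suc L))
    ≡⟨ filter-++ <²? (row′ zero) _ ⟩
  filter <²? (map (zero ,_) (map suc L)) ++ filter <²? (concatMap row′ (map suc L))
    ≡⟨ cong₂ _++_
         (filter-all <²? (Allₚ.map⁺ (Allₚ.map⁺ (All.tabulate {xs = L} (λ _ → ℕ.s≤s ℕ.z≤n)))))
         (trans (cong (filter <²?) (concatMap-map row′ suc L)) (filter-concatMap <²? (row′ ∘ suc) L)) ⟩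
  map (zero ,_) (map suc L) ++ concatMap (filter <²? ∘ row′ ∘ suc) L
    ≡⟨ cong (map (zero ,_) (map suc L) ++_)
         (trans (concatMap-cong row-suc L) (sym (map-concatMap suc² (filter <²? ∘ row) L))) ⟩
  map (zero ,_) (map suc L) ++ map suc² (concatMap (filter <²? ∘ row) L)
    ≡⟨ cong (λ K → map (zero ,_) (map suc L) ++ map suc² K)
         (trans (sym (filter-concatMap <²? row L)) (edges≡pairs n)) ⟩
  map (zero ,_) (map suc L) ++ map suc² (pairs L)
    ≡⟨ cong (map (zero ,_) (map suc L) ++_) (pairs-map suc L) ⟨
  pairs L′
    ≡⟨ cong pairs (allFin-suc n) ⟨
  pairs (allFin (suc n)) ∎
  where
  open ≡-Reasoning
  L = allFin n
  L′ = zero ∷ map suc L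
  <²? : ∀ {m} (e : Fin m × Fin m) → _
  <²? e = toℕ (proj₁ e) ℕ.<? toℕ (proj₂ e)
  row : Fin n → List (Fin n × Fin n)
  row i = map (i ,_) L
  row′ : Fin (suc n) → List (Fin (suc n) × Fin (suc n))
  row′ i = map (i ,_) L′
  suc² : Fin n × Fin n → Fin (suc n) × Fin (suc n)
  suc² e = suc (proj₁ e) , suc (proj₂ e)
  row-suc : ∀ i → filter <²? (row′ (suc i)) ≡ map suc² (filter <²? (row i))
  row-suc i = trans (cong (filter <²?) (trans (sym (map-∘ L)) (map-∘ L)))
    (filter-map <²? <²? suc² (λ _ → refl) (row i))

edges-< : ∀ {n} {e : Fin n × Fin n} → e ∈ edges n → toℕ (proj₁ e) ℕ.< toℕ (proj₂ e)
edges-< {n} e∈ = proj₂ (∈-filter⁻ (λ p → toℕ (proj₁ p) ℕ.<? toℕ (proj₂ p))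
  {xs = concatMap (λ i → map (i ,_) (allFin n)) (allFin n)} e∈)

edgesOf-⊆ : ∀ {n} (S : Subset n) {e : Fin n × Fin n} → e ∈ edgesOf S → e ∈ edges n
edgesOf-⊆ {n} S e∈ = proj₁ (∈-filter⁻ (λ p → (proj₁ p ∈? S) ×-dec (proj₂ p ∈? S)) {xs = edges n} e∈)

elements : ∀ {n} → Subset n → List (Fin n)
elements {n} S = filter (_∈? S) (allFin n)

edgesOf≡pairs : ∀ {n} (S : Subset n) → edgesOf S ≡ pairs (elements S)
edgesOf≡pairs {n} S = trans (cong (filter (λ p → (proj₁ p ∈? S) ×-dec (proj₂ p ∈? S))) (edges≡pairs n))
  (filter-pairs (_∈? S) (allFin n))

elements-false : ∀ {n} (S : Subset n) → elements (false Vec.∷ S) ≡ map suc (elements S)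
elements-false {n} S = trans (cong (filter (_∈? (false Vec.∷ S))) (allFin-suc n))
  (filter-map (_∈? (false Vec.∷ S)) (_∈? S) suc (λ _ → refl) (allFin n))

elements-true : ∀ {n} (S : Subset n) → elements (true Vec.∷ S) ≡ zero ∷ map suc (elements S)
elements-true {n} S = trans (cong (filter (_∈? (true Vec.∷ S))) (allFin-suc n))
  (cong (zero ∷_) (filter-map (_∈? (true Vec.∷ S)) (_∈? S) suc (λ _ → refl) (allFin n)))

-- The lists agree even in order, because `comb` and `subsets` both put the sets avoiding the first
-- vertex before those containing it. From here on a copy of K_t is a sublist of length t.
elements-copiesK : ∀ n t → map elements (copiesK n t) ≡ comb t (allFin n)
elements-copiesK zero    zero    = refl
elements-copiesK zero    (suc t) = refl
elements-copiesK (suc n) t = trans (cong (map elements) (filter-++ size? (map (false Vec.∷_) (subsets n)) _))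
  (trans (map-++ elements (filter size? (map (false Vec.∷_) (subsets n))) _)
    (trans (cong₂ _++_ without (with′ t)) (split t)))
  where
  size? : ∀ {m} (S : Subset m) → _
  size? S = ∣ S ∣ ℕ.≟ t
  without : map elements (filter size? (map (false Vec.∷_) (subsets n))) ≡ map (map suc) (comb t (allFin n))
  without = trans (cong (map elements) (filter-map size? size? (false Vec.∷_) (λ _ → refl) (subsets n)))
    (trans (sym (map-∘ (copiesK n t))) (trans (map-cong elements-false (copiesK n t))
      (trans (map-∘ (copiesK n t)) (cong (map (map suc)) (elements-copiesK n t)))))
  rest : ℕ → List (List (Fin (suc n)))
  rest zero    = []
  rest (suc t) = map (zero ∷_) (map (map suc) (comb t (allFin n)))
  with′ : ∀ t → map elements (filter (λ S → ∣ S ∣ ℕ.≟ t) (map (true Vec.∷_) (subsets n))) ≡ rest t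
  with′ zero    = cong (map elements) (filter-false (λ S → ∣ S ∣ ℕ.≟ 0) (true Vec.∷_) (λ _ → refl) (subsets n))
  with′ (suc t) = trans (cong (map elements)
      (filter-map (λ S → ∣ S ∣ ℕ.≟ suc t) (λ S → ∣ S ∣ ℕ.≟ t) (true Vec.∷_) (λ _ → refl) (subsets n)))
    (trans (sym (map-∘ (copiesK n t))) (trans (map-cong elements-true (copiesK n t))
      (trans (map-∘ {g = zero ∷_} {f = map suc ∘ elements} (copiesK n t)) (cong (map (zero ∷_))
        (trans (map-∘ (copiesK n t)) (cong (map (map suc)) (elements-copiesK n t)))))))
  split : ∀ t → map (map suc) (comb t (allFin n)) ++ rest t ≡ comb t (allFin (suc n))
  split zero    = refl
  split (suc t) = sym (trans (cong (comb (suc t)) (allFin-suc n))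
    (cong₂ _++_ (comb-map suc (suc t) (allFin n)) (cong (map (zero ∷_)) (comb-map suc t (allFin n)))))

module CliqueBound where

  open import Data.Rational using (ℚ; 0ℚ; 1ℚ; ½; _+_; _*_; _-_; -_; _≤_; _<_; 1/_; nonNegative; positive; ≢-nonZero; toℚᵘ)
  open import Data.Rational.Properties
  open import Data.Rational.Solver using (module +-*-Solver)
  open +-*-Solver using (solve; _:=_; _:+_; _:*_; _:-_; :-_; con)
  open ≤-Reasoning

  private variable
    x x′ y y′ z : ℚ
    xs : List A
    f g : A → ℚ

  -- Order and powers in the rationals.

  +-nonNeg : 0ℚ ≤ x → 0ℚ ≤ y → 0ℚ ≤ x + y
  +-nonNeg = +-mono-≤

  *-mono-≤ : 0ℚ ≤ x → x ≤ x′ → 0ℚ ≤ y → y ≤ y′ → x * y ≤ x′ * y′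
  *-mono-≤ {x} {x′} {y} {y′} 0≤x x≤x′ 0≤y y≤y′ = begin
    x * y    ≤⟨ *-monoˡ-≤-nonNeg x {{nonNegative 0≤x}} y≤y′ ⟩
    x * y′   ≤⟨ *-monoʳ-≤-nonNeg y′ {{nonNegative (≤-trans 0≤y y≤y′)}} x≤x′ ⟩
    x′ * y′  ∎

  *-monoˡ : 0ℚ ≤ z → x ≤ y → z * x ≤ z * y
  *-monoˡ {z} 0≤z = *-monoˡ-≤-nonNeg z {{nonNegative 0≤z}}

  *-nonNeg : 0ℚ ≤ x → 0ℚ ≤ y → 0ℚ ≤ x * y
  *-nonNeg {x} 0≤x 0≤y = ≤-trans (≤-reflexive (sym (*-zeroʳ x))) (*-monoˡ 0≤x 0≤y)

  neg-nonNeg : x ≤ 0ℚ → 0ℚ ≤ - x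
  neg-nonNeg = neg-antimono-≤

  square-nonNeg : ∀ x → 0ℚ ≤ x * x
  square-nonNeg x with ≤-total 0ℚ x
  ... | inj₁ 0≤x = *-nonNeg 0≤x 0≤x
  ... | inj₂ x≤0 = ≤-trans (*-nonNeg (neg-nonNeg x≤0) (neg-nonNeg x≤0))
    (≤-reflexive (solve 1 (λ x → (:- x) :* (:- x) := x :* x) refl x))

  x≤x+y : 0ℚ ≤ y → x ≤ x + y
  x≤x+y {y} {x} 0≤y = begin
    x      ≡⟨ +-identityʳ x ⟨
    x + 0ℚ ≤⟨ +-monoʳ-≤ x 0≤y ⟩
    x + y  ∎

  +-cancelʳ-≤ : ∀ z → x + z ≤ y + z → x ≤ y
  +-cancelʳ-≤ {x} {y} z x+z≤y+z = begin
    x             ≡⟨ cancel x z ⟩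
    (x + z) - z   ≤⟨ +-monoˡ-≤ (- z) x+z≤y+z ⟩
    (y + z) - z   ≡⟨ cancel y z ⟨
    y             ∎
    where
    cancel : ∀ x z → x ≡ (x + z) - z
    cancel = solve 2 (λ x z → x := (x :+ z) :- z) refl

  ≢0⇒> : 0ℚ ≤ x → ¬ x ≡ 0ℚ → 0ℚ < x
  ≢0⇒> {x} 0≤x x≢0 with 0ℚ <? x
  ... | yes 0<x = 0<x
  ... | no ¬0<x = contradiction (≤-antisym (≮⇒≥ ¬0<x) 0≤x) x≢0

  infixr 8 _^_
  _^_ : ℚ → ℕ → ℚ
  _^_ = powℚ

  ^-nonNeg : 0ℚ ≤ x → ∀ n → 0ℚ ≤ x ^ n
  ^-nonNeg 0≤x zero    = nonNegative⁻¹ 1ℚ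
  ^-nonNeg 0≤x (suc n) = *-nonNeg 0≤x (^-nonNeg 0≤x n)

  ^-mono-≤ : 0ℚ ≤ x → x ≤ y → ∀ n → x ^ n ≤ y ^ n
  ^-mono-≤ 0≤x x≤y zero    = ≤-refl
  ^-mono-≤ 0≤x x≤y (suc n) = *-mono-≤ 0≤x x≤y (^-nonNeg 0≤x n) (^-mono-≤ 0≤x x≤y n)

  ^-+ : ∀ x m n → x ^ (m ℕ.+ n) ≡ x ^ m * x ^ n
  ^-+ x zero    n = sym (*-identityˡ (x ^ n))
  ^-+ x (suc m) n = trans (cong (x *_) (^-+ x m n)) (sym (*-assoc x (x ^ m) (x ^ n)))

  1^ : ∀ n → 1ℚ ^ n ≡ 1ℚ
  1^ zero    = refl
  1^ (suc n) = trans (*-identityˡ (1ℚ ^ n)) (1^ n)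

  ^-distrib-* : ∀ x y n → (x * y) ^ n ≡ x ^ n * y ^ n
  ^-distrib-* x y zero    = refl
  ^-distrib-* x y (suc n) rewrite ^-distrib-* x y n =
    solve 4 (λ x y a b → (x :* y) :* (a :* b) := (x :* a) :* (y :* b)) refl x y (x ^ n) (y ^ n)

  ^-* : ∀ x m n → x ^ (m ℕ.* n) ≡ (x ^ n) ^ m
  ^-* x zero    n = refl
  ^-* x (suc m) n = trans (^-+ x n (m ℕ.* n)) (cong (x ^ n *_) (^-* x m n))

  ^-pos : 0ℚ < x → ∀ n → 0ℚ < x ^ n
  ^-pos 0<x zero    = positive⁻¹ 1ℚ
  ^-pos {x} 0<x (suc n) = begin-strict
    0ℚ        ≡⟨ *-zeroʳ x ⟨
    x * 0ℚ    <⟨ *-monoʳ-<-pos x {{positive 0<x}} (^-pos 0<x n) ⟩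
    x * x ^ n ∎

  -- The substitute for taking roots. If y < x then x is positive, so the factor x ^ n keeps the
  -- inequality strict even when y is zero.
  ^-cancel-≤ : 0ℚ ≤ y → ∀ n → x ^ suc n ≤ y ^ suc n → x ≤ y
  ^-cancel-≤ {y} {x} 0≤y n x^≤y^ with x ≤? y
  ... | yes x≤y = x≤y
  ... | no  x≰y = ⊥-elim (<-irrefl refl (<-≤-trans (begin-strict
    y * y ^ n ≤⟨ *-monoˡ 0≤y (^-mono-≤ 0≤y (<⇒≤ y<x) n) ⟩
    y * x ^ n <⟨ *-monoˡ-<-pos (x ^ n) {{positive (^-pos (≤-<-trans 0≤y y<x) n)}} y<x ⟩
    x * x ^ n ∎) x^≤y^))
    where
    y<x : y < x
    y<x = ≰⇒> x≰y

  x²≤y²⇒x≤y : 0ℚ ≤ y → x * x ≤ y * y → x ≤ y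
  x²≤y²⇒x≤y {y} {x} 0≤y x²≤y² = ^-cancel-≤ 0≤y 1
    (subst₂ _≤_ (cong (x *_) (sym (*-identityʳ x))) (cong (y *_) (sym (*-identityʳ y))) x²≤y²)

  -- Recursive, so that `ι (suc n)` is `1ℚ + ι n` by computation, the form in which the ring solver
  -- is given it.
  ι : ℕ → ℚ
  ι zero    = 0ℚ
  ι (suc n) = 1ℚ + ι n

  ι-nonNeg : ∀ n → 0ℚ ≤ ι n
  ι-nonNeg zero    = ≤-refl
  ι-nonNeg (suc n) = +-nonNeg (nonNegative⁻¹ 1ℚ) (ι-nonNeg n)

  ι-+ : ∀ m n → ι (m ℕ.+ n) ≡ ι m + ι n
  ι-+ zero    n = sym (+-identityˡ (ι n))
  ι-+ (suc m) n = trans (cong (1ℚ +_) (ι-+ m n)) (sym (+-assoc 1ℚ (ι m) (ι n)))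

  toℚᵘ-ι : ∀ n → toℚᵘ (ι n) ℚᵘ.≃ ℚᵘ.mkℚᵘ (ℤ.+ n) 0
  toℚᵘ-ι zero    = ℚᵘ.*≡* refl
  toℚᵘ-ι (suc n) = ℚᵘₚ.≃-trans (toℚᵘ-homo-+ 1ℚ (ι n))
    (ℚᵘₚ.≃-trans (ℚᵘₚ.+-congʳ ℚᵘ.1ℚᵘ (toℚᵘ-ι n))
      (ℚᵘ.*≡* (cong (λ k → (ℤ.1ℤ ℤ.+ k) ℤ.* ℤ.1ℤ) (ℤₚ.*-identityʳ (ℤ.+ n)))))

  -- Checked on unnormalised fractions, where equality is cross-multiplication and no gcd has to be
  -- computed.
  ι*recip : ∀ n → ι (suc n) * recip (suc n) ≡ 1ℚ
  ι*recip n = toℚᵘ-injective (ℚᵘₚ.≃-trans (toℚᵘ-homo-* (ι (suc n)) (recip (suc n)))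
    (ℚᵘₚ.≃-trans (ℚᵘₚ.*-cong (toℚᵘ-ι (suc n)) (toℚᵘ-fromℚᵘ (ℚᵘ.mkℚᵘ (ℤ.+ 1) n)))
      (ℚᵘ.*≡* (cong ℤ.+_ (lemma n)))))
    where
    lemma : ∀ n → suc n ℕ.* 1 ℕ.* 1 ≡ 1 ℕ.* (1 ℕ.* suc n)
    lemma n = trans (ℕₚ.*-identityʳ _) (trans (ℕₚ.*-identityʳ _) (sym (trans (ℕₚ.*-identityˡ _) (ℕₚ.*-identityˡ _))))

  recip-nonNeg : ∀ n → 0ℚ ≤ recip n
  recip-nonNeg zero    = ≤-refl
  recip-nonNeg (suc n) = nonNegative⁻¹ _ {{normalize-nonNeg 1 (suc n)}}

  -- The convex function x^(n+1) lies above its tangent at a. In the induction, b times the previous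
  -- inequality misses the new one by exactly (1 + n) a^n (b - a)², which is nonnegative.
  tangent : ∀ {a b} → 0ℚ ≤ a → 0ℚ ≤ b → ∀ n →
            (1ℚ + ι n) * (b * a ^ n) ≤ b ^ suc n + ι n * a ^ suc n
  tangent {a} {b} 0≤a 0≤b zero = ≤-reflexive
    (solve 2 (λ a b → (con 1ℚ :+ con 0ℚ) :* (b :* con 1ℚ) := b :* con 1ℚ :+ con 0ℚ :* (a :* con 1ℚ)) refl a b)
  tangent {a} {b} 0≤a 0≤b (suc n) = begin
    (1ℚ + (1ℚ + i)) * (b * (a * p))
      ≤⟨ x≤x+y (*-nonNeg (*-nonNeg (ι-nonNeg (suc n)) (^-nonNeg 0≤a n)) (square-nonNeg (b - a))) ⟩
    (1ℚ + (1ℚ + i)) * (b * (a * p)) + (1ℚ + i) * p * ((b - a) * (b - a))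
      ≡⟨ solve 4 (λ a b i p →
           (con 1ℚ :+ (con 1ℚ :+ i)) :* (b :* (a :* p)) :+ (con 1ℚ :+ i) :* p :* ((b :- a) :* (b :- a))
           := b :* ((con 1ℚ :+ i) :* (b :* p)) :+ ((con 1ℚ :+ i) :* (a :* (a :* p)) :- b :* (i :* (a :* p))))
           refl a b i p ⟩
    b * ((1ℚ + i) * (b * p)) + ((1ℚ + i) * (a * (a * p)) - b * (i * (a * p)))
      ≤⟨ +-monoˡ-≤ _ (*-monoˡ 0≤b (tangent 0≤a 0≤b n)) ⟩
    b * (q + i * (a * p)) + ((1ℚ + i) * (a * (a * p)) - b * (i * (a * p)))
      ≡⟨ solve 5 (λ a b i p q →
           b :* (q :+ i :* (a :* p)) :+ ((con 1ℚ :+ i) :* (a :* (a :* p)) :- b :* (i :* (a :* p)))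
           := b :* q :+ (con 1ℚ :+ i) :* (a :* (a :* p)))
           refl a b i p q ⟩
    b * q + (1ℚ + i) * (a * (a * p)) ∎
    where
    i = ι n
    p = a ^ n
    q = b ^ suc n

  -- Finite sums and products.

  ∑ ∏ : List A → (A → ℚ) → ℚ
  ∑ xs f = sumℚ (map f xs)
  ∏ xs f = prodℚ (map f xs)

  ∑-cong : (∀ {x} → x ∈ xs → f x ≡ g x) → ∑ xs f ≡ ∑ xs g
  ∑-cong {xs = []}     f≡g = refl
  ∑-cong {xs = _ ∷ xs} f≡g = cong₂ _+_ (f≡g (here refl)) (∑-cong (f≡g ∘ there))

  ∏-cong : (∀ {x} → x ∈ xs → f x ≡ g x) → ∏ xs f ≡ ∏ xs g
  ∏-cong {xs = []}     f≡g = refl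
  ∏-cong {xs = _ ∷ xs} f≡g = cong₂ _*_ (f≡g (here refl)) (∏-cong (f≡g ∘ there))

  ∑-mono-≤ : (∀ {x} → x ∈ xs → f x ≤ g x) → ∑ xs f ≤ ∑ xs g
  ∑-mono-≤ {xs = []}     f≤g = ≤-refl
  ∑-mono-≤ {xs = _ ∷ xs} f≤g = +-mono-≤ (f≤g (here refl)) (∑-mono-≤ (f≤g ∘ there))

  ∑-nonNeg : (∀ {x} → x ∈ xs → 0ℚ ≤ f x) → 0ℚ ≤ ∑ xs f
  ∑-nonNeg {xs = []}     0≤f = ≤-refl
  ∑-nonNeg {xs = _ ∷ xs} 0≤f = +-nonNeg (0≤f (here refl)) (∑-nonNeg (0≤f ∘ there))

  ∏-nonNeg : (∀ {x} → x ∈ xs → 0ℚ ≤ f x) → 0ℚ ≤ ∏ xs f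
  ∏-nonNeg {xs = []}     0≤f = nonNegative⁻¹ 1ℚ
  ∏-nonNeg {xs = _ ∷ xs} 0≤f = *-nonNeg (0≤f (here refl)) (∏-nonNeg (0≤f ∘ there))

  ∏-mono-≤ : (∀ {x} → x ∈ xs → 0ℚ ≤ f x) → (∀ {x} → x ∈ xs → f x ≤ g x) → ∏ xs f ≤ ∏ xs g
  ∏-mono-≤ {xs = []}     0≤f f≤g = ≤-refl
  ∏-mono-≤ {xs = _ ∷ xs} 0≤f f≤g = *-mono-≤ (0≤f (here refl)) (f≤g (here refl))
    (∏-nonNeg (0≤f ∘ there)) (∏-mono-≤ (0≤f ∘ there) (f≤g ∘ there))

  ∑-*ˡ : ∀ (xs : List A) c f → ∑ xs (λ x → c * f x) ≡ c * ∑ xs f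
  ∑-*ˡ []       c f = sym (*-zeroʳ c)
  ∑-*ˡ (x ∷ xs) c f = trans (cong (c * f x +_) (∑-*ˡ xs c f)) (sym (*-distribˡ-+ c (f x) (∑ xs f)))

  ∑-+ : ∀ (xs : List A) f g → ∑ xs (λ x → f x + g x) ≡ ∑ xs f + ∑ xs g
  ∑-+ []       f g = refl
  ∑-+ (x ∷ xs) f g = trans (cong (f x + g x +_) (∑-+ xs f g))
    (solve 4 (λ a b c d → (a :+ b) :+ (c :+ d) := (a :+ c) :+ (b :+ d)) refl (f x) (g x) (∑ xs f) (∑ xs g))

  ∏-* : ∀ (xs : List A) f g → ∏ xs (λ x → f x * g x) ≡ ∏ xs f * ∏ xs g
  ∏-* []       f g = refl
  ∏-* (x ∷ xs) f g = trans (cong (f x * g x *_) (∏-* xs f g))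
    (solve 4 (λ a b c d → (a :* b) :* (c :* d) := (a :* c) :* (b :* d)) refl (f x) (g x) (∏ xs f) (∏ xs g))

  ∑-const : ∀ (xs : List A) c → ∑ xs (λ _ → c) ≡ ι (length xs) * c
  ∑-const []       c = sym (*-zeroˡ c)
  ∑-const (x ∷ xs) c = trans (cong (c +_) (∑-const xs c))
    (solve 2 (λ c n → c :+ n :* c := (con 1ℚ :+ n) :* c) refl c (ι (length xs)))

  ∏-const : ∀ (xs : List A) c → ∏ xs (λ _ → c) ≡ c ^ length xs
  ∏-const []       c = refl
  ∏-const (x ∷ xs) c = cong (c *_) (∏-const xs c)

  ∏-^ : ∀ (xs : List A) f n → ∏ xs (λ x → f x ^ n) ≡ ∏ xs f ^ n
  ∏-^ xs f zero    = trans (∏-const xs 1ℚ) (1^ (length xs))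
  ∏-^ xs f (suc n) = trans (∏-* xs f (λ x → f x ^ n)) (cong (∏ xs f *_) (∏-^ xs f n))

  ∑-++ : ∀ (xs ys : List A) f → ∑ (xs ++ ys) f ≡ ∑ xs f + ∑ ys f
  ∑-++ []       ys f = sym (+-identityˡ (∑ ys f))
  ∑-++ (x ∷ xs) ys f = trans (cong (f x +_) (∑-++ xs ys f)) (sym (+-assoc (f x) (∑ xs f) (∑ ys f)))

  ∏-++ : ∀ (xs ys : List A) f → ∏ (xs ++ ys) f ≡ ∏ xs f * ∏ ys f
  ∏-++ []       ys f = sym (*-identityˡ (∏ ys f))
  ∏-++ (x ∷ xs) ys f = trans (cong (f x *_) (∏-++ xs ys f)) (sym (*-assoc (f x) (∏ xs f) (∏ ys f)))

  ∑-map : ∀ (h : A → A′) xs f → ∑ (map h xs) f ≡ ∑ xs (f ∘ h)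
  ∑-map h xs f = cong sumℚ (sym (map-∘ xs))

  ∏-map : ∀ (h : A → A′) xs f → ∏ (map h xs) f ≡ ∏ xs (f ∘ h)
  ∏-map h xs f = cong prodℚ (sym (map-∘ xs))

  -- The inequality of arithmetic and geometric means.

  mean : List A → (A → ℚ) → ℚ
  mean xs f = recip (length xs) * ∑ xs f

  ι*mean : ∀ (xs : List A) f → ι (length xs) * mean xs f ≡ ∑ xs f
  ι*mean []       f = refl
  ι*mean (x ∷ xs) f = trans (sym (*-assoc (ι (suc (length xs))) (recip (suc (length xs))) (∑ (x ∷ xs) f)))
    (trans (cong (_* ∑ (x ∷ xs) f) (ι*recip (length xs))) (*-identityˡ (∑ (x ∷ xs) f)))

  mean-nonNeg : (∀ {x} → x ∈ xs → 0ℚ ≤ f x) → 0ℚ ≤ mean xs f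
  mean-nonNeg {xs = xs} 0≤f = *-nonNeg (recip-nonNeg (length xs)) (∑-nonNeg 0≤f)

  -- Root-free, and with any upper bound c of the mean, since the applications know only such a
  -- bound. By induction the tail is replaced by powers of its mean a, and `tangent` at a, evaluated
  -- at c, absorbs the head.
  am-gm : ∀ {c} → 0ℚ ≤ c → (∀ {x} → x ∈ xs → 0ℚ ≤ f x) →
          ∑ xs f ≤ ι (length xs) * c → ∏ xs f ≤ c ^ length xs
  am-gm {xs = []} 0≤c 0≤f ∑≤ = ≤-refl
  am-gm {xs = x ∷ xs} {f = f} {c} 0≤c 0≤f ∑≤ = begin
    f x * ∏ xs f  ≤⟨ *-monoˡ (0≤f (here refl)) (am-gm 0≤a (0≤f ∘ there) (≤-reflexive (sym (ι*mean xs f)))) ⟩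
    f x * a ^ n   ≤⟨ +-cancelʳ-≤ (ι n * a ^ suc n) (begin
      f x * a ^ n + ι n * (a * a ^ n)  ≡⟨ solve 4 (λ x a n p → x :* p :+ n :* (a :* p) := (x :+ n :* a) :* p)
                                            refl (f x) a (ι n) (a ^ n) ⟩
      (f x + ι n * a) * a ^ n          ≡⟨ cong (λ s → (f x + s) * a ^ n) (ι*mean xs f) ⟩
      (f x + ∑ xs f) * a ^ n           ≤⟨ *-monoʳ-≤-nonNeg (a ^ n) {{nonNegative (^-nonNeg 0≤a n)}} ∑≤ ⟩
      (1ℚ + ι n) * c * a ^ n           ≡⟨ *-assoc (1ℚ + ι n) c (a ^ n) ⟩
      (1ℚ + ι n) * (c * a ^ n)         ≤⟨ tangent 0≤a 0≤c n ⟩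
      c ^ suc n + ι n * a ^ suc n      ∎) ⟩
    c ^ suc n     ∎
    where
    n = length xs
    a = mean xs f
    0≤a = mean-nonNeg (0≤f ∘ there)

  ∏≤mean^length : (∀ {x} → x ∈ xs → 0ℚ ≤ f x) → ∏ xs f ≤ mean xs f ^ length xs
  ∏≤mean^length {xs = xs} {f = f} 0≤f = am-gm (mean-nonNeg 0≤f) 0≤f (≤-reflexive (sym (ι*mean xs f)))

  x^n+y^n≤[x+y]^n : ∀ {x y} → 0ℚ ≤ x → 0ℚ ≤ y → ∀ n → x ^ suc n + y ^ suc n ≤ (x + y) ^ suc n
  x^n+y^n≤[x+y]^n {x} {y} 0≤x 0≤y n = begin
    x * x ^ n + y * y ^ n              ≤⟨ +-mono-≤ (*-monoˡ 0≤x (^-mono-≤ 0≤x (x≤x+y 0≤y) n))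
                                                   (*-monoˡ 0≤y (^-mono-≤ 0≤y y≤x+y n)) ⟩
    x * (x + y) ^ n + y * (x + y) ^ n  ≡⟨ *-distribʳ-+ ((x + y) ^ n) x y ⟨
    (x + y) * (x + y) ^ n              ∎
    where
    y≤x+y : y ≤ x + y
    y≤x+y = subst (y ≤_) (+-comm y x) (x≤x+y 0≤x)

  ∑-^-≤ : (∀ {x} → x ∈ xs → 0ℚ ≤ f x) → ∀ n → ∑ xs (λ x → f x ^ suc n) ≤ ∑ xs f ^ suc n
  ∑-^-≤ {xs = []}                 0≤f n = ^-nonNeg ≤-refl (suc n)
  ∑-^-≤ {xs = x ∷ xs} {f = f} 0≤f n = ≤-trans (+-monoʳ-≤ (f x ^ suc n) (∑-^-≤ (0≤f ∘ there) n))
    (x^n+y^n≤[x+y]^n (0≤f (here refl)) (∑-nonNeg (0≤f ∘ there)) n)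

  -- Double counting over picks and sublists.

  ∑-picks-proj₁ : ∀ (xs : List A) f → ∑ (picks xs) (f ∘ proj₁) ≡ ∑ xs f
  ∑-picks-proj₁ xs f = trans (sym (∑-map proj₁ (picks xs) f)) (cong (λ ys → ∑ ys f) (map-proj₁-picks xs))

  ∏-picks-proj₁ : ∀ (xs : List A) f → ∏ (picks xs) (f ∘ proj₁) ≡ ∏ xs f
  ∏-picks-proj₁ xs f = trans (sym (∏-map proj₁ (picks xs) f)) (cong (λ ys → ∏ ys f) (map-proj₁-picks xs))

  ∑-picks : ∀ (xs : List A) f {v T} → (v , T) ∈ picks xs → ∑ xs f ≡ f v + ∑ T f
  ∑-picks xs f = All.lookup (go xs)
    where
    swap : ∀ a b c → a + (b + c) ≡ b + (a + c)
    swap = solve 3 (λ a b c → a :+ (b :+ c) := b :+ (a :+ c)) refl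
    go : ∀ xs → All (λ p → ∑ xs f ≡ f (proj₁ p) + ∑ (proj₂ p) f) (picks xs)
    go []       = []
    go (x ∷ xs) = refl ∷ Allₚ.map⁺ (All.map
      (λ {p} eq → trans (cong (f x +_) eq) (swap (f x) (f (proj₁ p)) (∑ (proj₂ p) f))) (go xs))

  -- Each element is missing from exactly one of the `suc n` complements, so it occurs in n of them.
  ∏-picks-∏ : ∀ (xs : List A) f n → length xs ≡ suc n →
              ∏ (picks xs) (λ p → ∏ (proj₂ p) f) ≡ ∏ xs f ^ n
  ∏-picks-∏ (x ∷ [])         f zero    eq = refl
  ∏-picks-∏ (x ∷ xs@(y ∷ _)) f (suc n) eq = begin-equality
    ∏ xs f * ∏ (map (map₂ (x ∷_)) (picks xs)) (λ p → ∏ (proj₂ p) f)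
      ≡⟨ cong (∏ xs f *_) (∏-map (map₂ (x ∷_)) (picks xs) (λ p → ∏ (proj₂ p) f)) ⟩
    ∏ xs f * ∏ (picks xs) (λ p → f x * ∏ (proj₂ p) f)
      ≡⟨ cong (∏ xs f *_) (∏-* (picks xs) (λ _ → f x) (λ p → ∏ (proj₂ p) f)) ⟩
    ∏ xs f * (∏ (picks xs) (λ _ → f x) * ∏ (picks xs) (λ p → ∏ (proj₂ p) f))
      ≡⟨ cong₂ (λ a b → ∏ xs f * (a * b))
           (trans (∏-const (picks xs) (f x)) (cong (f x ^_) (trans (length-picks xs) (ℕₚ.suc-injective eq))))
           (∏-picks-∏ xs f n (ℕₚ.suc-injective eq)) ⟩
    ∏ xs f * (f x ^ suc n * ∏ xs f ^ n)
      ≡⟨ solve 3 (λ a b c → a :* (b :* c) := b :* (a :* c)) refl (∏ xs f) (f x ^ suc n) (∏ xs f ^ n) ⟩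
    f x ^ suc n * ∏ xs f ^ suc n
      ≡⟨ ^-distrib-* (f x) (∏ xs f) (suc n) ⟨
    (f x * ∏ xs f) ^ suc n ∎

  -- Choosing a set and then an element of it is choosing the element and then the rest. This is
  -- what allows a sum over cliques to be grouped by vertex.
  ∑-comb-picks : ∀ {A : Set} n (xs : List A) (F : A → List A → ℚ) →
    ∑ (comb (suc n) xs) (λ T → ∑ (picks T) (λ p → F (proj₁ p) (proj₂ p)))
    ≡ ∑ (picks xs) (λ p → ∑ (comb n (proj₂ p)) (F (proj₁ p)))
  ∑-comb-picks n []       F = refl
  ∑-comb-picks {A} n (x ∷ xs) F = begin-equality
    ∑ (comb (suc n) xs ++ map (x ∷_) (comb n xs)) G
      ≡⟨ trans (∑-++ (comb (suc n) xs) _ G) (cong (∑ (comb (suc n) xs) G +_) (∑-map (x ∷_) (comb n xs) G)) ⟩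
    ∑ (comb (suc n) xs) G + ∑ (comb n xs) (λ T → F x T + ∑ (map (map₂ (x ∷_)) (picks T)) F′)
      ≡⟨ cong₂ _+_ (∑-comb-picks n xs F)
           (trans (∑-+ (comb n xs) (F x) _)
             (cong (∑ (comb n xs) (F x) +_) (∑-cong {xs = comb n xs} (λ {T} _ → ∑-map (map₂ (x ∷_)) (picks T) F′)))) ⟩
    ∑ (picks xs) (λ p → ∑ (comb n (proj₂ p)) (F (proj₁ p)))
      + (∑ (comb n xs) (F x) + ∑ (comb n xs) (λ T → ∑ (picks T) (λ p → F (proj₁ p) (x ∷ proj₂ p))))
      ≡⟨ solve 3 (λ a b c → a :+ (b :+ c) := b :+ (a :+ c)) refl
           (∑ (picks xs) (λ p → ∑ (comb n (proj₂ p)) (F (proj₁ p)))) (∑ (comb n xs) (F x))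
           (∑ (comb n xs) (λ T → ∑ (picks T) (λ p → F (proj₁ p) (x ∷ proj₂ p)))) ⟩
    ∑ (comb n xs) (F x) + (∑ (picks xs) (λ p → ∑ (comb n (proj₂ p)) (F (proj₁ p)))
      + ∑ (comb n xs) (λ T → ∑ (picks T) (λ p → F (proj₁ p) (x ∷ proj₂ p))))
      -- The terms with chosen element x stand apart. The other two sums, over sets without x and
      -- over sets containing x beside the chosen element, merge into the n-sublists of
      -- `x ∷ proj₂ p`.
      ≡⟨ cong (∑ (comb n xs) (F x) +_) (lemma n) ⟩
    ∑ (comb n xs) (F x) + ∑ (picks xs) (λ p → ∑ (comb n (x ∷ proj₂ p)) (F (proj₁ p)))
      ≡⟨ cong (∑ (comb n xs) (F x) +_) (∑-map (map₂ (x ∷_)) (picks xs) (λ p → ∑ (comb n (proj₂ p)) (F (proj₁ p)))) ⟨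
    ∑ (comb n xs) (F x) + ∑ (map (map₂ (x ∷_)) (picks xs)) (λ p → ∑ (comb n (proj₂ p)) (F (proj₁ p))) ∎
    where
    F′ : A × List A → ℚ
    F′ p = F (proj₁ p) (proj₂ p)
    G : List A → ℚ
    G T = ∑ (picks T) F′
    lemma : ∀ n → ∑ (picks xs) (λ p → ∑ (comb n (proj₂ p)) (F (proj₁ p)))
      + ∑ (comb n xs) (λ T → ∑ (picks T) (λ p → F (proj₁ p) (x ∷ proj₂ p)))
      ≡ ∑ (picks xs) (λ p → ∑ (comb n (x ∷ proj₂ p)) (F (proj₁ p)))
    lemma zero    = +-identityʳ _
    lemma (suc n) = trans
      (cong (∑ (picks xs) (λ p → ∑ (comb (suc n) (proj₂ p)) (F (proj₁ p))) +_)
        (∑-comb-picks n xs (λ v T → F v (x ∷ T))))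
      (trans (sym (∑-+ (picks xs) (λ p → ∑ (comb (suc n) (proj₂ p)) (F (proj₁ p))) _))
        (∑-cong {xs = picks xs} (λ {p} _ → sym (trans (∑-++ (comb (suc n) (proj₂ p)) _ (F (proj₁ p)))
          (cong (∑ (comb (suc n) (proj₂ p)) (F (proj₁ p)) +_) (∑-map (x ∷_) (comb n (proj₂ p)) (F (proj₁ p))))))))

  ∑-comb-≤ : (∀ x → 0ℚ ≤ f x) → ∀ n xs {T} → T ∈ comb n xs → ∑ T f ≤ ∑ xs f
  ∑-comb-≤ {A} {f} 0≤f n xs = All.lookup (go n xs)
    where
    go : ∀ n (xs : List A) → All (λ T → ∑ T f ≤ ∑ xs f) (comb n xs)
    go zero    xs       = ∑-nonNeg {xs = xs} (λ {x} _ → 0≤f x) ∷ []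
    go (suc n) []       = []
    go (suc n) (x ∷ xs) = Allₚ.++⁺
      (All.map (λ ≤∑ → ≤-trans ≤∑ (subst (∑ xs f ≤_) (+-comm (∑ xs f) (f x)) (x≤x+y (0≤f x)))) (go (suc n) xs))
      (Allₚ.map⁺ (All.map (+-monoʳ-≤ (f x)) (go n xs)))

  ι-triangle : ∀ n → ι (triangle n) ≡ ½ * (ι n * ι (suc n))
  ι-triangle zero    = refl
  ι-triangle (suc n) = begin-equality
    ι (suc n ℕ.+ triangle n)                         ≡⟨ ι-+ (suc n) (triangle n) ⟩
    ι (suc n) + ι (triangle n)                       ≡⟨ cong (ι (suc n) +_) (ι-triangle n) ⟩
    (1ℚ + ι n) + ½ * (ι n * (1ℚ + ι n))       ≡⟨ solve 1 (λ n → (con 1ℚ :+ n) :+ con ½ :* (n :* (con 1ℚ :+ n))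
                                                  := con ½ :* ((con 1ℚ :+ n) :* (con 1ℚ :+ (con 1ℚ :+ n)))) refl (ι n) ⟩
    ½ * (ι (suc n) * ι (suc (suc n)))         ∎

  ∑-replicate : ∀ n (x : ℚ) → ∑ (replicate n x) (λ y → y) ≡ ι n * x
  ∑-replicate n x = trans (cong sumℚ (go n)) (trans (∑-const (replicate n x) x) (cong (λ k → ι k * x) (length-replicate n)))
    where
    go : ∀ n → map (λ y → y) (replicate n x) ≡ map (λ _ → x) (replicate n x)
    go zero    = refl
    go (suc n) = cong (x ∷_) (go n)

  ∏-replicate : ∀ n (x : ℚ) → ∏ (replicate n x) (λ y → y) ≡ x ^ n
  ∏-replicate zero    x = refl
  ∏-replicate (suc n) x = cong (x *_) (∏-replicate n x)

  -- AM-GM with weights 1, i and k, obtained by repeating y and z in the list.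
  am-gm-3 : ∀ {x y z c} i k → 0ℚ ≤ c → 0ℚ ≤ x → 0ℚ ≤ y → 0ℚ ≤ z →
            x + (ι i * y + ι k * z) ≤ ι (suc (i ℕ.+ k)) * c →
            x * (y ^ i * z ^ k) ≤ c ^ suc (i ℕ.+ k)
  am-gm-3 {x} {y} {z} {c} i k 0≤c 0≤x 0≤y 0≤z h = begin
    x * (y ^ i * z ^ k)   ≡⟨ cong (x *_) (trans (∏-++ (replicate i y) (replicate k z) (λ y → y))
                               (cong₂ _*_ (∏-replicate i y) (∏-replicate k z))) ⟨
    ∏ ws (λ y → y)        ≤⟨ am-gm 0≤c (All.lookup all) ∑≤ ⟩
    c ^ length ws         ≡⟨ cong (c ^_) len ⟩
    c ^ suc (i ℕ.+ k)     ∎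
    where
    ws = x ∷ (replicate i y ++ replicate k z)
    len : length ws ≡ suc (i ℕ.+ k)
    len = cong suc (trans (length-++ (replicate i y)) (cong₂ ℕ._+_ (length-replicate i) (length-replicate k)))
    all : All (0ℚ ≤_) ws
    all = 0≤x ∷ Allₚ.++⁺ (Allₚ.replicate⁺ i 0≤y) (Allₚ.replicate⁺ k 0≤z)
    ∑≤ : ∑ ws (λ y → y) ≤ ι (length ws) * c
    ∑≤ = subst₂ _≤_
      (cong (x +_) (sym (trans (∑-++ (replicate i y) (replicate k z) (λ y → y))
        (cong₂ _+_ (∑-replicate i y) (∑-replicate k z)))))
      (cong (λ n → ι n * c) (sym len)) h

  -- The products P of f and Λ of the midpoints satisfy P² ≤ P aⁿ ≤ Λ².
  ∏≤∏-midpoint : ∀ {a} → (∀ x → 0ℚ ≤ f x) → 0ℚ ≤ a → ∑ xs f ≤ ι (length xs) * a →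
                 ∏ xs f ≤ ∏ xs (λ x → ½ * (f x + a))
  ∏≤∏-midpoint {f = f} {xs = xs} {a = a} 0≤f 0≤a ∑≤ = x²≤y²⇒x≤y (∏-nonNeg 0≤ℓ) (begin
    P * P                            ≤⟨ *-monoˡ (∏-nonNeg 0≤f′) (am-gm 0≤a 0≤f′ ∑≤) ⟩
    P * a ^ length xs                ≡⟨ trans (∏-* xs f (λ _ → a)) (cong (P *_) (∏-const xs a)) ⟨
    ∏ xs (λ x → f x * a)             ≤⟨ ∏-mono-≤ {xs = xs} (λ {x} _ → *-nonNeg (0≤f x) 0≤a) (λ {x} _ → fa≤ℓ² (f x)) ⟩
    ∏ xs (λ x → ℓ x * ℓ x)           ≡⟨ ∏-* xs ℓ ℓ ⟩
    ∏ xs ℓ * ∏ xs ℓ                  ∎)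
    where
    P = ∏ xs f
    ℓ : _ → ℚ
    ℓ x = ½ * (f x + a)
    0≤f′ : ∀ {x} → x ∈ xs → 0ℚ ≤ f x
    0≤f′ {x} _ = 0≤f x
    0≤ℓ : ∀ {x} → x ∈ xs → 0ℚ ≤ ℓ x
    0≤ℓ {x} _ = *-nonNeg (nonNegative⁻¹ ½) (+-nonNeg (0≤f x) 0≤a)
    fa≤ℓ² : ∀ y → y * a ≤ (½ * (y + a)) * (½ * (y + a))
    fa≤ℓ² y = begin
      y * a                                              ≤⟨ x≤x+y (square-nonNeg (½ * (y - a))) ⟩
      y * a + (½ * (y - a)) * (½ * (y - a))              ≡⟨ solve 2 (λ y a →
        y :* a :+ (con ½ :* (y :- a)) :* (con ½ :* (y :- a)) := (con ½ :* (y :+ a)) :* (con ½ :* (y :+ a))) refl y a ⟩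
      (½ * (y + a)) * (½ * (y + a))                      ∎

  -- The polynomial majorant of the half-integer powers.

  module Majorant {A : Set} (f : A → ℚ) (0≤f : ∀ x → 0ℚ ≤ f x) where

    factor : ℕ → ℚ → A → ℚ
    factor j a x = f x * (f x * (½ * (f x + a)) ^ j)

    -- With s = j + 1 = length T, majorant j R T bounds ∏_T f^((s+1)/2) from above whenever ∑_T f ≤ R.
    -- The factor has the degree and the slope at f = R / s for which the AM-GM steps of both
    -- ∑-majorant-≤ and ∏^≤majorant² are equalities when f is constantly R / s.
    majorant : ℕ → ℚ → List A → ℚ
    majorant zero    R T = ∑ T f
    majorant (suc j) R T = recip (2 ℕ.+ j) * ∑ (picks T) (λ p →
      factor j (recip (2 ℕ.+ j) * R) (proj₁ p) * majorant j (R - f (proj₁ p)) (proj₂ p))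

    factor-nonNeg : ∀ j {a} → 0ℚ ≤ a → ∀ x → 0ℚ ≤ factor j a x
    factor-nonNeg j 0≤a x = *-nonNeg (0≤f x) (*-nonNeg (0≤f x)
      (^-nonNeg (*-nonNeg (nonNegative⁻¹ ½) (+-nonNeg (0≤f x) 0≤a)) j))

    ∑f-nonNeg : ∀ T → 0ℚ ≤ ∑ T f
    ∑f-nonNeg T = ∑-nonNeg {xs = T} (λ {x} _ → 0≤f x)

    ∑-picks-≤ : ∀ {R} T {v T′} → ∑ T f ≤ R → (v , T′) ∈ picks T → ∑ T′ f ≤ R - f v
    ∑-picks-≤ {R} T {v} {T′} ∑≤R p∈ = +-cancelʳ-≤ (f v) (begin
      ∑ T′ f + f v    ≡⟨ +-comm (∑ T′ f) (f v) ⟩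
      f v + ∑ T′ f    ≡⟨ ∑-picks T f p∈ ⟨
      ∑ T f           ≤⟨ ∑≤R ⟩
      R               ≡⟨ solve 2 (λ R v → R := (R :- v) :+ v) refl R (f v) ⟩
      (R - f v) + f v ∎)

    majorant-nonNeg : ∀ j {R} T → ∑ T f ≤ R → 0ℚ ≤ majorant j R T
    majorant-nonNeg zero    T ∑≤R = ∑f-nonNeg T
    majorant-nonNeg (suc j) T ∑≤R = *-nonNeg (recip-nonNeg (2 ℕ.+ j)) (∑-nonNeg (λ {p} p∈ →
      *-nonNeg (factor-nonNeg j (*-nonNeg (recip-nonNeg (2 ℕ.+ j)) (≤-trans (∑f-nonNeg T) ∑≤R)) (proj₁ p))
               (majorant-nonNeg j (proj₂ p) (∑-picks-≤ T ∑≤R p∈))))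

    -- Grouped by the picked element v, the sum runs over sublists of X without v. The total of f
    -- there is exactly `R - f v`, the parameter that `majorant` hands down, so the induction
    -- hypothesis applies.
    ∑-majorant-≤ : ∀ j X → ∑ (comb (suc j) X) (majorant j (∑ X f)) ≤ (recip (suc j) * ∑ X f) ^ triangle (suc j)
    ∑-majorant-≤ zero X = ≤-reflexive (begin-equality
      ∑ (comb 1 X) (λ T → ∑ T f)                           ≡⟨ ∑-cong {xs = comb 1 X} (λ {T} _ → ∑-picks-proj₁ T f) ⟨
      ∑ (comb 1 X) (λ T → ∑ (picks T) (f ∘ proj₁))         ≡⟨ ∑-comb-picks 0 X (λ v _ → f v) ⟩
      ∑ (picks X) (λ p → f (proj₁ p) + 0ℚ)                 ≡⟨ ∑-cong {xs = picks X} (λ {p} _ → +-identityʳ (f (proj₁ p))) ⟩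
      ∑ (picks X) (f ∘ proj₁)                              ≡⟨ ∑-picks-proj₁ X f ⟩
      ∑ X f                                                ≡⟨ solve 1 (λ x → x := (con 1ℚ :* x) :* con 1ℚ) refl (∑ X f) ⟩
      (1ℚ * ∑ X f) * 1ℚ                                    ∎)
    ∑-majorant-≤ (suc j) X = begin
      ∑ (comb (2 ℕ.+ j) X) (λ T → r * ∑ (picks T) (λ p → F (proj₁ p) (proj₂ p)))
        ≡⟨ ∑-*ˡ (comb (2 ℕ.+ j) X) r _ ⟩
      r * ∑ (comb (2 ℕ.+ j) X) (λ T → ∑ (picks T) (λ p → F (proj₁ p) (proj₂ p)))
        ≡⟨ cong (r *_) (∑-comb-picks (suc j) X F) ⟩
      r * ∑ (picks X) (λ p → ∑ (comb (suc j) (proj₂ p)) (F (proj₁ p)))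
        ≤⟨ *-monoˡ 0≤r (∑-mono-≤ step) ⟩
      r * ∑ (picks X) (λ p → a ^ N * f (proj₁ p))
        ≡⟨ cong (r *_) (trans (∑-*ˡ (picks X) (a ^ N) (f ∘ proj₁)) (cong (a ^ N *_) (∑-picks-proj₁ X f))) ⟩
      r * (a ^ N * R)
        ≡⟨ solve 3 (λ r p R → r :* (p :* R) := (r :* R) :* p) refl r (a ^ N) R ⟩
      a ^ suc N ∎
      where
      r = recip (2 ℕ.+ j)
      R = ∑ X f
      a = r * R
      N = suc (j ℕ.+ triangle (suc j))
      0≤r = recip-nonNeg (2 ℕ.+ j)
      0≤a = *-nonNeg 0≤r (∑f-nonNeg X)
      F : A → List A → ℚ
      F v T = factor j a v * majorant j (R - f v) T
      step : ∀ {p} → p ∈ picks X → ∑ (comb (suc j) (proj₂ p)) (F (proj₁ p)) ≤ a ^ N * f (proj₁ p)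
      step {v , T} p∈ = begin
        ∑ (comb (suc j) T) (F v)
          ≡⟨ ∑-*ˡ (comb (suc j) T) (factor j a v) (majorant j (R - f v)) ⟩
        factor j a v * ∑ (comb (suc j) T) (majorant j (R - f v))
          ≡⟨ cong (λ s → factor j a v * ∑ (comb (suc j) T) (majorant j s)) R-fv ⟩
        factor j a v * ∑ (comb (suc j) T) (majorant j (∑ T f))
          ≤⟨ *-monoˡ (factor-nonNeg j 0≤a v) (∑-majorant-≤ j T) ⟩
        factor j a v * w ^ triangle (suc j)
          -- One `f v` is set aside, to be summed over v to R. The other N = 1 + j +
          -- `triangle (suc j)` factors have sum N a, so their product is at most `a ^ N`.
          ≡⟨ solve 3 (λ x y z → (x :* (x :* y)) :* z := (x :* (y :* z)) :* x) refl (f v) (ℓ ^ j) (w ^ triangle (suc j)) ⟩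
        (f v * (ℓ ^ j * w ^ triangle (suc j))) * f v
          ≤⟨ *-monoʳ-≤-nonNeg (f v) {{nonNegative (0≤f v)}} (am-gm-3 j (triangle (suc j)) 0≤a (0≤f v)
               (*-nonNeg (nonNegative⁻¹ ½) (+-nonNeg (0≤f v) 0≤a)) (*-nonNeg (recip-nonNeg (suc j)) (∑f-nonNeg T))
               (≤-reflexive balance)) ⟩
        a ^ N * f v ∎
        where
        ℓ = ½ * (f v + a)
        w = recip (suc j) * ∑ T f
        i = ι j
        R-fv : R - f v ≡ ∑ T f
        R-fv = trans (cong (_- f v) (∑-picks X f p∈)) (solve 2 (λ x y → (x :+ y) :- x := y) refl (f v) (∑ T f))
        ιw : ι (suc j) * w ≡ ι (2 ℕ.+ j) * a - f v
        ιw = begin-equality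
          ι (suc j) * (recip (suc j) * ∑ T f)  ≡⟨ *-assoc (ι (suc j)) (recip (suc j)) (∑ T f) ⟨
          ι (suc j) * recip (suc j) * ∑ T f    ≡⟨ cong (_* ∑ T f) (ι*recip j) ⟩
          1ℚ * ∑ T f                           ≡⟨ cong (1ℚ *_) R-fv ⟨
          1ℚ * (R - f v)                       ≡⟨ solve 2 (λ R x → con 1ℚ :* (R :- x) := con 1ℚ :* R :- x) refl R (f v) ⟩
          1ℚ * R - f v                         ≡⟨ cong (λ u → u * R - f v) (ι*recip (suc j)) ⟨
          ι (2 ℕ.+ j) * r * R - f v            ≡⟨ cong (_- f v) (*-assoc (ι (2 ℕ.+ j)) r R) ⟩
          ι (2 ℕ.+ j) * a - f v                ∎
        -- Since (j + 1) w = (j + 2) a - f v, the coefficient of `f v` is 1 + j/2 - (j + 2)/2 = 0: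
        -- the slope ½ in `factor` is the one that cancels it.
        balance : f v + (ι j * ℓ + ι (triangle (suc j)) * w) ≡ ι N * a
        balance = begin-equality
          f v + (i * ℓ + ι (triangle (suc j)) * w)
            ≡⟨ cong (λ u → f v + (i * ℓ + u * w)) (ι-triangle (suc j)) ⟩
          f v + (i * ℓ + ½ * (ι (suc j) * ι (2 ℕ.+ j)) * w)
            ≡⟨ solve 5 (λ x i ℓ s w → x :+ (i :* ℓ :+ con ½ :* (s :* (con 1ℚ :+ s)) :* w)
                 := x :+ (i :* ℓ :+ con ½ :* (con 1ℚ :+ s) :* (s :* w))) refl (f v) i ℓ (ι (suc j)) w ⟩
          f v + (i * ℓ + ½ * ι (2 ℕ.+ j) * (ι (suc j) * w))
            ≡⟨ cong (λ u → f v + (i * ℓ + ½ * ι (2 ℕ.+ j) * u)) ιw ⟩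
          f v + (i * ℓ + ½ * ι (2 ℕ.+ j) * (ι (2 ℕ.+ j) * a - f v))
            ≡⟨ solve 3 (λ x i a → let s = con 1ℚ :+ i ; t = con 1ℚ :+ s in
                 x :+ (i :* (con ½ :* (x :+ a)) :+ con ½ :* t :* (t :* a :- x))
                 := (con 1ℚ :+ (i :+ con ½ :* (s :* t))) :* a) refl (f v) i a ⟩
          (1ℚ + (i + ½ * (ι (suc j) * ι (2 ℕ.+ j)))) * a
            ≡⟨ cong (λ u → (1ℚ + (i + u)) * a) (ι-triangle (suc j)) ⟨
          (1ℚ + (i + ι (triangle (suc j)))) * a
            ≡⟨ cong (λ u → (1ℚ + u) * a) (ι-+ j (triangle (suc j))) ⟨
          ι N * a ∎

    -- AM-GM over the picked element. For s = `length T` at least 2 and P the product of f over T,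
    -- the factors multiply to at least P^s by `∏≤∏-midpoint`, and the smaller majorants contribute
    -- P^(s(s-1)/2) by induction. The s-th root of P^(s(s+1)/2) is P^((s+1)/2); squaring makes this
    -- exponent integral, and raising to the power s avoids the root.
    ∏^≤majorant² : ∀ j R T → length T ≡ suc j → ∑ T f ≤ R →
                   ∏ T f ^ (2 ℕ.+ j) ≤ majorant j R T * majorant j R T
    ∏^≤majorant² zero    R (v ∷ []) len ∑≤R = ≤-reflexive
      (solve 1 (λ x → (x :* con 1ℚ) :* ((x :* con 1ℚ) :* con 1ℚ) := (x :+ con 0ℚ) :* (x :+ con 0ℚ)) refl (f v))
    ∏^≤majorant² (suc j) R T len ∑≤R = ^-cancel-≤ (square-nonNeg m) (suc j) (begin
      (P ^ suc s) ^ s                             ≡⟨ cong (_^ s) (solve 2 (λ p q → p :* (p :* q) := p :* p :* q)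
                                                       refl P (P ^ suc j)) ⟩
      (P * P * P ^ suc j) ^ s                     ≡⟨ trans (^-distrib-* (P * P) (P ^ suc j) s)
                                                       (cong (_* (P ^ suc j) ^ s) (^-distrib-* P P s)) ⟩
      P ^ s * P ^ s * (P ^ suc j) ^ s             ≤⟨ *-monoʳ-≤-nonNeg _ {{nonNegative (^-nonNeg (^-nonNeg 0≤P (suc j)) s)}}
                                                       (*-mono-≤ (^-nonNeg 0≤P s) P^s≤K (^-nonNeg 0≤P s) P^s≤K) ⟩
      K * K * (P ^ suc j) ^ s                     ≡⟨ ∏-rhs ⟨
      ∏ (picks T) (λ p → (k (proj₁ p) * k (proj₁ p)) * ∏ (proj₂ p) f ^ s)
                                                  ≤⟨ ∏-mono-≤ (λ {p} _ → *-nonNeg (square-nonNeg (k (proj₁ p)))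
                                                       (^-nonNeg (∏f-nonNeg (proj₂ p)) s)) step ⟩
      ∏ (picks T) (λ p → U p * U p)               ≡⟨ ∏-* (picks T) U U ⟩
      ∏ (picks T) U * ∏ (picks T) U               ≤⟨ *-mono-≤ (∏-nonNeg 0≤U) ∏U≤ (∏-nonNeg 0≤U) ∏U≤ ⟩
      m ^ s * m ^ s                               ≡⟨ ^-distrib-* m m s ⟨
      (m * m) ^ s                                 ∎)
      where
      s = 2 ℕ.+ j
      r = recip s
      a = r * R
      m = majorant (suc j) R T
      P = ∏ T f
      k : A → ℚ
      k = factor j a
      K = ∏ T k
      U : A × List A → ℚ
      U p = k (proj₁ p) * majorant j (R - f (proj₁ p)) (proj₂ p)
      ∏f-nonNeg : ∀ S → 0ℚ ≤ ∏ S f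
      ∏f-nonNeg S = ∏-nonNeg {xs = S} (λ {x} _ → 0≤f x)
      0≤P = ∏f-nonNeg T
      0≤a : 0ℚ ≤ a
      0≤a = *-nonNeg (recip-nonNeg s) (≤-trans (∑f-nonNeg T) ∑≤R)
      0≤U : ∀ {p} → p ∈ picks T → 0ℚ ≤ U p
      0≤U {p} p∈ = *-nonNeg (factor-nonNeg j 0≤a (proj₁ p)) (majorant-nonNeg j (proj₂ p) (∑-picks-≤ T ∑≤R p∈))
      ∏U≤ : ∏ (picks T) U ≤ m ^ s
      ∏U≤ = subst (λ n → ∏ (picks T) U ≤ (recip n * ∑ (picks T) U) ^ n) (trans (length-picks T) len) (∏≤mean^length 0≤U)
      ∑≤a : ∑ T f ≤ ι (length T) * a
      ∑≤a = begin
        ∑ T f                ≤⟨ ∑≤R ⟩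
        R                    ≡⟨ *-identityˡ R ⟨
        1ℚ * R               ≡⟨ cong (_* R) (ι*recip (suc j)) ⟨
        ι s * r * R          ≡⟨ *-assoc (ι s) r R ⟩
        ι s * a              ≡⟨ cong (λ n → ι n * a) len ⟨
        ι (length T) * a     ∎
      P^s≤K : P ^ s ≤ K
      P^s≤K = begin
        P * (P * P ^ j)                                ≤⟨ *-monoˡ 0≤P (*-monoˡ 0≤P (^-mono-≤ 0≤P (∏≤∏-midpoint {xs = T} 0≤f 0≤a ∑≤a) j)) ⟩
        P * (P * ∏ T (λ x → ½ * (f x + a)) ^ j)        ≡⟨ cong (λ q → P * (P * q)) (∏-^ T (λ x → ½ * (f x + a)) j) ⟨
        P * (P * ∏ T (λ x → (½ * (f x + a)) ^ j))      ≡⟨ cong (P *_) (∏-* T f (λ x → (½ * (f x + a)) ^ j)) ⟨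
        P * ∏ T (λ x → f x * (½ * (f x + a)) ^ j)      ≡⟨ ∏-* T f (λ x → f x * (½ * (f x + a)) ^ j) ⟨
        K                                              ∎
      ∏-rhs : ∏ (picks T) (λ p → (k (proj₁ p) * k (proj₁ p)) * ∏ (proj₂ p) f ^ s) ≡ K * K * (P ^ suc j) ^ s
      ∏-rhs = trans (∏-* (picks T) (λ p → k (proj₁ p) * k (proj₁ p)) (λ p → ∏ (proj₂ p) f ^ s)) (cong₂ _*_
        (trans (∏-* (picks T) (k ∘ proj₁) (k ∘ proj₁)) (cong (λ q → q * q) (∏-picks-proj₁ T k)))
        (trans (∏-^ (picks T) (λ p → ∏ (proj₂ p) f) s) (cong (_^ s) (∏-picks-∏ T f (suc j) len))))
      step : ∀ {p} → p ∈ picks T → (k (proj₁ p) * k (proj₁ p)) * ∏ (proj₂ p) f ^ s ≤ U p * U p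
      step {v , T′} p∈ = begin
        k v * k v * ∏ T′ f ^ s      ≤⟨ *-monoˡ (square-nonNeg (k v)) (∏^≤majorant² j (R - f v) T′
                                         (ℕₚ.suc-injective (trans (sym (picks-length T p∈)) len)) (∑-picks-≤ T ∑≤R p∈)) ⟩
        k v * k v * (b * b)         ≡⟨ solve 2 (λ k b → k :* k :* (b :* b) := (k :* b) :* (k :* b)) refl (k v) b ⟩
        (k v * b) * (k v * b)       ∎
        where b = majorant j (R - f v) T′

  -- Reciprocals.

  recip-unique : ∀ n {x} → ι (suc n) * x ≡ 1ℚ → x ≡ recip (suc n)
  recip-unique n {x} eq = begin-equality
    x                             ≡⟨ *-identityʳ x ⟨
    x * 1ℚ                        ≡⟨ cong (x *_) (ι*recip n) ⟨
    x * (ι (suc n) * recip (suc n))  ≡⟨ solve 3 (λ x i r → x :* (i :* r) := (i :* x) :* r) refl x (ι (suc n)) (recip (suc n)) ⟩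
    (ι (suc n) * x) * recip (suc n)  ≡⟨ cong (_* recip (suc n)) eq ⟩
    1ℚ * recip (suc n)            ≡⟨ *-identityˡ (recip (suc n)) ⟩
    recip (suc n)                 ∎

  -- As m = s t / 2, the constant 1/s of the star estimate and 2/t of the degree estimate combine to
  -- 1/m.
  recip-triangle : ∀ j → recip (suc j) * ((1ℚ + 1ℚ) * recip (2 ℕ.+ j)) ≡ recip (triangle (suc j))
  recip-triangle j = recip-unique (j ℕ.+ triangle j) (begin-equality
    ι (triangle (suc j)) * (ρ * ((1ℚ + 1ℚ) * r))
      ≡⟨ cong (_* (ρ * ((1ℚ + 1ℚ) * r))) (ι-triangle (suc j)) ⟩
    ½ * (ι (suc j) * ι (2 ℕ.+ j)) * (ρ * ((1ℚ + 1ℚ) * r))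
      ≡⟨ solve 4 (λ s t ρ r → con ½ :* (s :* t) :* (ρ :* ((con 1ℚ :+ con 1ℚ) :* r)) := (s :* ρ) :* (t :* r))
           refl (ι (suc j)) (ι (2 ℕ.+ j)) ρ r ⟩
    (ι (suc j) * ρ) * (ι (2 ℕ.+ j) * r)
      ≡⟨ cong₂ _*_ (ι*recip j) (ι*recip (suc j)) ⟩
    1ℚ ∎)
    where
    ρ = recip (suc j)
    r = recip (2 ℕ.+ j)

  -- inv 0 = 0
  inv : ℚ → ℚ
  inv x with x ≟ 0ℚ
  ... | yes _  = 0ℚ
  ... | no x≢0 = 1/_ x {{≢-nonZero x≢0}}

  inv-*ʳ : ∀ {x} → ¬ x ≡ 0ℚ → x * inv x ≡ 1ℚ
  inv-*ʳ {x} x≢0 with x ≟ 0ℚ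
  ... | yes x≡0 = contradiction x≡0 x≢0
  ... | no x≢0′ = *-inverseʳ x {{≢-nonZero x≢0′}}

  inv-nonNeg : ∀ {x} → 0ℚ ≤ x → 0ℚ ≤ inv x
  inv-nonNeg {x} 0≤x with x ≟ 0ℚ
  ... | yes _  = ≤-refl
  ... | no x≢0 = <⇒≤ (positive⁻¹ _ {{1/pos⇒pos x {{positive (≢0⇒> 0≤x x≢0)}}}})

  ∏-inv : ∀ {A : Set} (xs : List A) f → ¬ ∏ xs f ≡ 0ℚ → ∏ xs f * ∏ xs (inv ∘ f) ≡ 1ℚ
  ∏-inv []       f ∏≢0 = refl
  ∏-inv (x ∷ xs) f ∏≢0 = begin-equality
    (f x * ∏ xs f) * (inv (f x) * ∏ xs (inv ∘ f))
      ≡⟨ solve 4 (λ a b c d → (a :* b) :* (c :* d) := (a :* c) :* (b :* d)) refl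
           (f x) (∏ xs f) (inv (f x)) (∏ xs (inv ∘ f)) ⟩
    (f x * inv (f x)) * (∏ xs f * ∏ xs (inv ∘ f))
      ≡⟨ cong₂ _*_ (inv-*ʳ {f x} λ fx≡0 → ∏≢0 (trans (cong (_* ∏ xs f) fx≡0) (*-zeroˡ (∏ xs f))))
           (∏-inv xs f λ ∏≡0 → ∏≢0 (trans (cong (f x *_) ∏≡0) (*-zeroʳ (f x)))) ⟩
    1ℚ ∎

  -- The bound on the total weight of t-cliques.

  module WeightedClique {A : Set} (a : A → A → ℚ) (0≤a : ∀ v w → 0ℚ ≤ a v w)
    (a-sym : ∀ v w → a v w ≡ a w v) (a-diag : ∀ v → a v v ≡ 0ℚ) where

    weight : A × A → ℚ
    weight e = a (proj₁ e) (proj₂ e)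

    cliqueWeight : List A → ℚ
    cliqueWeight S = ∏ (pairs S) weight

    cliqueWeight-nonNeg : ∀ S → 0ℚ ≤ cliqueWeight S
    cliqueWeight-nonNeg S = ∏-nonNeg {xs = pairs S} (λ {e} _ → 0≤a (proj₁ e) (proj₂ e))

    -- Every edge lies in the stars of both its ends. This is μ(S) = ∏ y^½ with the root cleared.
    ∏-picks-star : ∀ S → ∏ (picks S) (λ p → ∏ (proj₂ p) (a (proj₁ p))) ≡ cliqueWeight S * cliqueWeight S
    ∏-picks-star []       = refl
    ∏-picks-star (x ∷ xs) = begin-equality
      s * ∏ (map (map₂ (x ∷_)) (picks xs)) star
        ≡⟨ cong (s *_) (trans (∏-map (map₂ (x ∷_)) (picks xs) star) (∏-* (picks xs) (λ p → a (proj₁ p) x) star)) ⟩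
      s * (∏ (picks xs) (λ p → a (proj₁ p) x) * ∏ (picks xs) star)
        ≡⟨ cong₂ (λ b c → s * (b * c))
             (trans (∏-picks-proj₁ xs (λ v → a v x)) (∏-cong {xs = xs} (λ {v} _ → a-sym v x)))
             (∏-picks-star xs) ⟩
      s * (s * (c * c))
        ≡⟨ solve 2 (λ s c → s :* (s :* (c :* c)) := (s :* c) :* (s :* c)) refl s c ⟩
      (s * c) * (s * c)
        ≡⟨ cong (λ q → q * q) (trans (∏-++ (map (x ,_) xs) (pairs xs) weight)
             (cong (_* c) (∏-map (x ,_) xs weight))) ⟨
      cliqueWeight (x ∷ xs) * cliqueWeight (x ∷ xs) ∎
      where
      star : A × List A → ℚ
      star p = ∏ (proj₂ p) (a (proj₁ p))
      s = ∏ xs (a x)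
      c = cliqueWeight xs

    ∑-picks-star : ∀ S → ∑ (picks S) (λ p → ∑ (proj₂ p) (a (proj₁ p))) ≡ ∑ (pairs S) weight + ∑ (pairs S) weight
    ∑-picks-star []       = refl
    ∑-picks-star (x ∷ xs) = begin-equality
      s + ∑ (map (map₂ (x ∷_)) (picks xs)) star
        ≡⟨ cong (s +_) (trans (∑-map (map₂ (x ∷_)) (picks xs) star) (∑-+ (picks xs) (λ p → a (proj₁ p) x) star)) ⟩
      s + (∑ (picks xs) (λ p → a (proj₁ p) x) + ∑ (picks xs) star)
        ≡⟨ cong₂ (λ b c → s + (b + c))
             (trans (∑-picks-proj₁ xs (λ v → a v x)) (∑-cong {xs = xs} (λ {v} _ → a-sym v x)))
             (∑-picks-star xs) ⟩
      s + (s + (c + c))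
        ≡⟨ solve 2 (λ s c → s :+ (s :+ (c :+ c)) := (s :+ c) :+ (s :+ c)) refl s c ⟩
      (s + c) + (s + c)
        ≡⟨ cong (λ q → q + q) (trans (∑-++ (map (x ,_) xs) (pairs xs) weight)
             (cong (_+ c) (∑-map (x ,_) xs weight))) ⟨
      ∑ (pairs (x ∷ xs)) weight + ∑ (pairs (x ∷ xs)) weight ∎
      where
      star : A × List A → ℚ
      star p = ∑ (proj₂ p) (a (proj₁ p))
      s = ∑ xs (a x)
      c = ∑ (pairs xs) weight

    module _ (X : List A) (total : ∑ (pairs X) weight ≡ 1ℚ) (j : ℕ) where
      open Majorant using (majorant; majorant-nonNeg; ∑-majorant-≤; ∏^≤majorant²; ∑-picks-≤)

      -- The sum may include v itself because the diagonal is zero; so it is also the total over the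
      -- star of v.
      deg : A → ℚ
      deg v = ∑ X (a v)

      deg-nonNeg : ∀ v → 0ℚ ≤ deg v
      deg-nonNeg v = ∑-nonNeg {xs = X} (λ {w} _ → 0≤a v w)

      deg-picks : ∀ {v T} → (v , T) ∈ picks X → deg v ≡ ∑ T (a v)
      deg-picks {v} {T} p∈ = trans (∑-picks X (a v) p∈)
        (trans (cong (_+ ∑ T (a v)) (a-diag v)) (+-identityˡ (∑ T (a v))))

      ∑-deg : ∑ X deg ≡ 1ℚ + 1ℚ
      ∑-deg = begin-equality
        ∑ X deg                                            ≡⟨ ∑-picks-proj₁ X deg ⟨
        ∑ (picks X) (deg ∘ proj₁)                          ≡⟨ ∑-cong deg-picks ⟩
        ∑ (picks X) (λ p → ∑ (proj₂ p) (a (proj₁ p)))      ≡⟨ ∑-picks-star X ⟩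
        ∑ (pairs X) weight + ∑ (pairs X) weight            ≡⟨ cong₂ _+_ total total ⟩
        1ℚ + 1ℚ                                            ∎

      t e : ℕ
      t = 2 ℕ.+ j
      e = j ℕ.+ triangle j

      r ρ θ : ℚ
      r = recip t
      ρ = recip (suc j)
      θ = (1ℚ + 1ℚ) * r

      0≤θ : 0ℚ ≤ θ
      0≤θ = *-nonNeg (nonNegative⁻¹ (1ℚ + 1ℚ)) (recip-nonNeg t)

      ιt*θ : ι t * θ ≡ 1ℚ + 1ℚ
      ιt*θ = begin-equality
        ι t * ((1ℚ + 1ℚ) * r)  ≡⟨ solve 2 (λ t r → t :* ((con 1ℚ :+ con 1ℚ) :* r) := (t :* r) :* (con 1ℚ :+ con 1ℚ)) refl (ι t) r ⟩
        (ι t * r) * (1ℚ + 1ℚ)  ≡⟨ cong (_* (1ℚ + 1ℚ)) (ι*recip (suc j)) ⟩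
        1ℚ + 1ℚ                ∎

      -- The coefficient ((2/t) / d v)^(m-1), with e = m - 1. At degree zero `inv` gives 0, so `h v`
      -- is 0 if e is positive and 1 if e = 0.
      h : A → ℚ
      h v = (θ * inv (deg v)) ^ e

      h-nonNeg : ∀ v → 0ℚ ≤ h v
      h-nonNeg v = ^-nonNeg (*-nonNeg 0≤θ (inv-nonNeg (deg-nonNeg v))) e

      U : A → List A → ℚ
      U v T = h v * majorant (a v) (0≤a v) j (deg v) T

      U′ : A × List A → ℚ
      U′ p = U (proj₁ p) (proj₂ p)

      module _ {S : List A} (S∈ : S ∈ comb t X) where
        len : length S ≡ t
        len = comb-length t X S∈

        star≤deg : ∀ {v T} → (v , T) ∈ picks S → ∑ T (a v) ≤ deg v
        star≤deg {v} {T} p∈ = begin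
          ∑ T (a v)          ≡⟨ +-identityˡ (∑ T (a v)) ⟨
          0ℚ + ∑ T (a v)     ≡⟨ cong (_+ ∑ T (a v)) (a-diag v) ⟨
          a v v + ∑ T (a v)  ≡⟨ ∑-picks S (a v) p∈ ⟨
          ∑ S (a v)          ≤⟨ ∑-comb-≤ (0≤a v) t X S∈ ⟩
          deg v              ∎

        picks-len : ∀ {v T} → (v , T) ∈ picks S → length T ≡ suc j
        picks-len p∈ = ℕₚ.suc-injective (trans (sym (picks-length S p∈)) len)

        U′-nonNeg : ∀ {p} → p ∈ picks S → 0ℚ ≤ U′ p
        U′-nonNeg {v , T} p∈ = *-nonNeg (h-nonNeg v) (majorant-nonNeg (a v) (0≤a v) j T (star≤deg p∈))

        mean-U′-nonNeg : 0ℚ ≤ r * ∑ (picks S) U′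
        mean-U′-nonNeg = *-nonNeg (recip-nonNeg t) (∑-nonNeg U′-nonNeg)

        -- For the degenerate case: a vertex of degree zero forces the weight of S to vanish. A
        -- crude bound suffices for this, with `deg v` in place of `deg v` / s as the mean of the
        -- star.
        cliqueWeight²≤∏deg^ : cliqueWeight S * cliqueWeight S ≤ ∏ S deg ^ suc j
        cliqueWeight²≤∏deg^ = begin
          cliqueWeight S * cliqueWeight S                         ≡⟨ ∏-picks-star S ⟨
          ∏ (picks S) (λ p → ∏ (proj₂ p) (a (proj₁ p)))           ≤⟨ ∏-mono-≤ (λ {p} _ → ∏-nonNeg {xs = proj₂ p} (λ {w} _ → 0≤a (proj₁ p) w)) step ⟩
          ∏ (picks S) (λ p → deg (proj₁ p) ^ suc j)               ≡⟨ ∏-picks-proj₁ S (λ v → deg v ^ suc j) ⟩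
          ∏ S (λ v → deg v ^ suc j)                               ≡⟨ ∏-^ S deg (suc j) ⟩
          ∏ S deg ^ suc j                                         ∎
          where
          step : ∀ {p} → p ∈ picks S → ∏ (proj₂ p) (a (proj₁ p)) ≤ deg (proj₁ p) ^ suc j
          step {v , T} p∈ = subst (λ n → ∏ T (a v) ≤ deg v ^ n) (picks-len p∈)
            (am-gm {xs = T} (deg-nonNeg v) (λ {w} _ → 0≤a v w) (begin
              ∑ T (a v)               ≤⟨ star≤deg p∈ ⟩
              deg v                   ≤⟨ x≤x+y (*-nonNeg (ι-nonNeg j) (deg-nonNeg v)) ⟩
              deg v + ι j * deg v     ≡⟨ solve 2 (λ d i → d :+ i :* d := (con 1ℚ :+ i) :* d) refl (deg v) (ι j) ⟩
              ι (suc j) * deg v       ≡⟨ cong (λ n → ι n * deg v) (picks-len p∈) ⟨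
              ι (length T) * deg v    ∎))

        -- The degrees on S sum to at most 2 = t θ, so their product is at most θ^t. Thus the
        -- coefficients cannot lower the geometric mean of the stars.
        1≤∏h : ¬ ∏ S deg ≡ 0ℚ → 1ℚ ≤ ∏ S h
        1≤∏h ∏≢0 = begin
          1ℚ                                    ≡⟨ 1^ e ⟨
          1ℚ ^ e                                ≤⟨ ^-mono-≤ (nonNegative⁻¹ 1ℚ) (begin
            1ℚ                                    ≡⟨ ∏-inv S deg ∏≢0 ⟨
            ∏ S deg * ∏ S (inv ∘ deg)             ≤⟨ *-monoʳ-≤-nonNeg (∏ S (inv ∘ deg)) {{nonNegative (∏-nonNeg {xs = S} (λ {v} _ → inv-nonNeg (deg-nonNeg v)))}}
                                                       (am-gm {xs = S} 0≤θ (λ {v} _ → deg-nonNeg v) ∑deg≤) ⟩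
            θ ^ length S * ∏ S (inv ∘ deg)        ≡⟨ trans (∏-* S (λ _ → θ) (inv ∘ deg)) (cong (_* ∏ S (inv ∘ deg)) (∏-const S θ)) ⟨
            ∏ S (λ v → θ * inv (deg v))           ∎) e ⟩
          ∏ S (λ v → θ * inv (deg v)) ^ e       ≡⟨ ∏-^ S (λ v → θ * inv (deg v)) e ⟨
          ∏ S h                                 ∎
          where
          ∑deg≤ : ∑ S deg ≤ ι (length S) * θ
          ∑deg≤ = begin
            ∑ S deg           ≤⟨ ∑-comb-≤ deg-nonNeg t X S∈ ⟩
            ∑ X deg           ≡⟨ ∑-deg ⟩
            1ℚ + 1ℚ           ≡⟨ ιt*θ ⟨
            ι t * θ           ≡⟨ cong (λ n → ι n * θ) len ⟨
            ι (length S) * θ  ∎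

        cliqueWeight≤mean : cliqueWeight S ≤ r * ∑ (picks S) U′
        cliqueWeight≤mean with ∏ S deg ≟ 0ℚ
        ... | yes ∏≡0 = ≤-trans (x²≤y²⇒x≤y ≤-refl (begin
          P * P             ≤⟨ cliqueWeight²≤∏deg^ ⟩
          ∏ S deg ^ suc j   ≡⟨ cong (_^ suc j) ∏≡0 ⟩
          0ℚ * 0ℚ ^ j       ≡⟨ *-zeroˡ (0ℚ ^ j) ⟩
          0ℚ * 0ℚ           ∎)) mean-U′-nonNeg
          where P = cliqueWeight S
        -- Squaring clears the half-integer powers in the stars and the power t clears the root in
        -- AM-GM. The product of all y^t is then `(P * P) ^ t` exactly, and the coefficients enter
        -- only through `1≤∏h`.
        ... | no ∏≢0 = x²≤y²⇒x≤y mean-U′-nonNeg (^-cancel-≤ (square-nonNeg m) (suc j) (begin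
          (P * P) ^ t                              ≡⟨ *-identityˡ ((P * P) ^ t) ⟨
          1ℚ * (P * P) ^ t                         ≤⟨ *-monoʳ-≤-nonNeg _ {{nonNegative (^-nonNeg (square-nonNeg P) t)}}
                                                        (*-mono-≤ 0≤1 (1≤∏h ∏≢0) 0≤1 (1≤∏h ∏≢0)) ⟩
          ∏ S h * ∏ S h * (P * P) ^ t              ≡⟨ ∏-rhs ⟨
          ∏ (picks S) (λ p → (h (proj₁ p) * h (proj₁ p)) * ∏ (proj₂ p) (a (proj₁ p)) ^ t)
                                                   ≤⟨ ∏-mono-≤ (λ {p} _ → *-nonNeg (square-nonNeg (h (proj₁ p)))
                                                        (^-nonNeg (∏-nonNeg {xs = proj₂ p} (λ {w} _ → 0≤a (proj₁ p) w)) t)) step ⟩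
          ∏ (picks S) (λ p → U′ p * U′ p)          ≡⟨ ∏-* (picks S) U′ U′ ⟩
          ∏ (picks S) U′ * ∏ (picks S) U′          ≤⟨ *-mono-≤ (∏-nonNeg U′-nonNeg) ∏U≤ (∏-nonNeg U′-nonNeg) ∏U≤ ⟩
          m ^ t * m ^ t                            ≡⟨ ^-distrib-* m m t ⟨
          (m * m) ^ t                              ∎))
          where
          P = cliqueWeight S
          m = r * ∑ (picks S) U′
          0≤1 = nonNegative⁻¹ 1ℚ
          ∏U≤ : ∏ (picks S) U′ ≤ m ^ t
          ∏U≤ = subst (λ n → ∏ (picks S) U′ ≤ (recip n * ∑ (picks S) U′) ^ n) (trans (length-picks S) len) (∏≤mean^length U′-nonNeg)
          ∏-rhs : ∏ (picks S) (λ p → (h (proj₁ p) * h (proj₁ p)) * ∏ (proj₂ p) (a (proj₁ p)) ^ t) ≡ ∏ S h * ∏ S h * (P * P) ^ t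
          ∏-rhs = trans (∏-* (picks S) (λ p → h (proj₁ p) * h (proj₁ p)) (λ p → ∏ (proj₂ p) (a (proj₁ p)) ^ t)) (cong₂ _*_
            (trans (∏-* (picks S) (h ∘ proj₁) (h ∘ proj₁)) (cong (λ q → q * q) (∏-picks-proj₁ S h)))
            (trans (∏-^ (picks S) (λ p → ∏ (proj₂ p) (a (proj₁ p))) t) (cong (_^ t) (∏-picks-star S))))
          step : ∀ {p} → p ∈ picks S → (h (proj₁ p) * h (proj₁ p)) * ∏ (proj₂ p) (a (proj₁ p)) ^ t ≤ U′ p * U′ p
          step {v , T} p∈ = begin
            h v * h v * ∏ T (a v) ^ t   ≤⟨ *-monoˡ (square-nonNeg (h v)) (∏^≤majorant² (a v) (0≤a v) j (deg v) T
                                             (picks-len p∈) (star≤deg p∈)) ⟩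
            h v * h v * (b * b)         ≡⟨ solve 2 (λ k b → k :* k :* (b :* b) := (k :* b) :* (k :* b)) refl (h v) b ⟩
            (h v * b) * (h v * b)       ∎
            where b = majorant (a v) (0≤a v) j (deg v) T

      -- The exponent in `h` is one less than m, so the star bound becomes linear in the degree. At
      -- degree zero both sides vanish, whatever `inv` returns there.
      h*deg^ : ∀ v → h v * (ρ * deg v) ^ suc e ≡ (ρ ^ suc e * θ ^ e) * deg v
      h*deg^ v = begin-equality
        (θ * i) ^ e * (ρ * d) ^ suc e
          ≡⟨ cong₂ _*_ (^-distrib-* θ i e) (^-distrib-* ρ d (suc e)) ⟩
        (θ ^ e * i ^ e) * (ρ ^ suc e * (d * d ^ e))
          ≡⟨ solve 5 (λ p q s d u → (p :* q) :* (s :* (d :* u)) := (s :* p) :* (d :* (u :* q))) refl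
               (θ ^ e) (i ^ e) (ρ ^ suc e) d (d ^ e) ⟩
        (ρ ^ suc e * θ ^ e) * (d * (d ^ e * i ^ e))
          ≡⟨ cong (λ q → (ρ ^ suc e * θ ^ e) * (d * q)) (^-distrib-* d i e) ⟨
        (ρ ^ suc e * θ ^ e) * (d * (d * i) ^ e)
          ≡⟨ cong ((ρ ^ suc e * θ ^ e) *_) lemma ⟩
        (ρ ^ suc e * θ ^ e) * d ∎
        where
        d = deg v
        i = inv d
        lemma : d * (d * i) ^ e ≡ d
        lemma = go (d ≟ 0ℚ)
          where
          go : Dec (d ≡ 0ℚ) → d * (d * i) ^ e ≡ d
          go (yes d≡0) = trans (cong (_* (d * i) ^ e) d≡0) (trans (*-zeroˡ ((d * i) ^ e)) (sym d≡0))
          go (no d≢0)  = trans (cong (λ q → d * q ^ e) (inv-*ʳ d≢0)) (trans (cong (d *_) (1^ e)) (*-identityʳ d))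

      ∑-cliqueWeight-≤ : ∑ (comb t X) cliqueWeight ≤ recip (triangle (suc j)) ^ triangle (suc j)
      ∑-cliqueWeight-≤ = begin
        ∑ (comb t X) cliqueWeight
          ≤⟨ ∑-mono-≤ cliqueWeight≤mean ⟩
        ∑ (comb t X) (λ S → r * ∑ (picks S) U′)
          ≡⟨ trans (∑-*ˡ (comb t X) r (λ S → ∑ (picks S) U′)) (cong (r *_) (∑-comb-picks (suc j) X U)) ⟩
        r * ∑ (picks X) (λ p → ∑ (comb (suc j) (proj₂ p)) (U (proj₁ p)))
          -- For fixed v, T runs over the s-subsets of X without v, where the weights `a v` total
          -- `deg v`; hence `∑-majorant-≤` applies with R = `deg v`.
          ≤⟨ *-monoˡ (recip-nonNeg t) (∑-mono-≤ step) ⟩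
        r * ∑ (picks X) (λ p → c * deg (proj₁ p))
          ≡⟨ cong (r *_) (trans (∑-*ˡ (picks X) c (deg ∘ proj₁))
               (cong (c *_) (trans (∑-picks-proj₁ X deg) ∑-deg))) ⟩
        r * (c * (1ℚ + 1ℚ))
          ≡⟨ solve 3 (λ r p q → r :* ((p :* q) :* (con 1ℚ :+ con 1ℚ)) := p :* (((con 1ℚ :+ con 1ℚ) :* r) :* q)) refl
               r (ρ ^ suc e) (θ ^ e) ⟩
        ρ ^ suc e * θ ^ suc e
          ≡⟨ ^-distrib-* ρ θ (suc e) ⟨
        (ρ * θ) ^ suc e
          ≡⟨ cong (_^ suc e) (recip-triangle j) ⟩
        recip (triangle (suc j)) ^ triangle (suc j) ∎
        where
        c = ρ ^ suc e * θ ^ e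
        step : ∀ {p} → p ∈ picks X → ∑ (comb (suc j) (proj₂ p)) (U (proj₁ p)) ≤ c * deg (proj₁ p)
        step {v , T} p∈ = begin
          ∑ (comb (suc j) T) (U v)
            ≡⟨ ∑-*ˡ (comb (suc j) T) (h v) (M (deg v)) ⟩
          h v * ∑ (comb (suc j) T) (M (deg v))
            ≡⟨ cong (λ s → h v * ∑ (comb (suc j) T) (M s)) (deg-picks p∈) ⟩
          h v * ∑ (comb (suc j) T) (M (∑ T (a v)))
            ≤⟨ *-monoˡ (h-nonNeg v) (∑-majorant-≤ (a v) (0≤a v) j T) ⟩
          h v * (ρ * ∑ T (a v)) ^ suc e
            ≡⟨ cong (λ s → h v * (ρ * s) ^ suc e) (deg-picks p∈) ⟨
          h v * (ρ * deg v) ^ suc e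
            ≡⟨ h*deg^ v ⟩
          c * deg v ∎
          where
          M : ℚ → List A → ℚ
          M = majorant (a v) (0≤a v) j

  -- From masses on edges to symmetric weights.

  module _ {n : ℕ} (μ w : Mass n) (w≡μ : ∀ i j → toℕ i ℕ.< toℕ j → w i j ≡ μ i j) where

    ∑-edges : ∑ (edges n) (λ e → μ (proj₁ e) (proj₂ e)) ≡ ∑ (pairs (allFin n)) (λ e → w (proj₁ e) (proj₂ e))
    ∑-edges = trans
      (∑-cong {xs = edges n} (λ {e} e∈ → sym (w≡μ (proj₁ e) (proj₂ e) (edges-< e∈))))
      (cong (λ es → ∑ es (λ e → w (proj₁ e) (proj₂ e))) (edges≡pairs n))

    -- A mass is read only at i < j, so w may be the symmetrisation of μ, as for the upper bound, or
    -- μ itself, as for the uniform mass.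
    βB≡∑-comb : ∀ t k → βB n μ t k ≡ ∑ (comb t (allFin n)) (λ T → ∏ (pairs T) (λ e → w (proj₁ e) (proj₂ e)) ^ k)
    βB≡∑-comb t k = trans (∑-cong {xs = copiesK n t} (λ {S} _ → cong (_^ k) (μOf≡ S)))
      (trans (sym (∑-map elements (copiesK n t) _))
        (cong (λ Ts → ∑ Ts (λ T → ∏ (pairs T) (λ e → w (proj₁ e) (proj₂ e)) ^ k)) (elements-copiesK n t)))
      where
      μOf≡ : ∀ S → μOf μ S ≡ ∏ (pairs (elements S)) (λ e → w (proj₁ e) (proj₂ e))
      μOf≡ S = trans
        (∏-cong {xs = edgesOf S} (λ {e} e∈ →
          sym (w≡μ (proj₁ e) (proj₂ e) (edges-< (edgesOf-⊆ S e∈)))))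
        (cong (λ es → ∏ es (λ e → w (proj₁ e) (proj₂ e))) (edgesOf≡pairs S))

  -- Values of μ on and below the diagonal are unconstrained, so they are overwritten; this also
  -- yields nonnegativity everywhere.
  symmetrise : ∀ {n} → Mass n → Mass n
  symmetrise μ i j with Finₚ.<-cmp i j
  ... | tri< _ _ _ = μ i j
  ... | tri≈ _ _ _ = 0ℚ
  ... | tri> _ _ _ = μ j i

  module _ {n : ℕ} (μ : Mass n) where

    symmetrise-< : ∀ i j → toℕ i ℕ.< toℕ j → symmetrise μ i j ≡ μ i j
    symmetrise-< i j i<j with Finₚ.<-cmp i j
    ... | tri< _ _ _   = refl
    ... | tri≈ i≮j _ _ = contradiction i<j i≮j
    ... | tri> i≮j _ _ = contradiction i<j i≮j

    symmetrise-sym : ∀ i j → symmetrise μ i j ≡ symmetrise μ j i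
    symmetrise-sym i j with Finₚ.<-cmp i j | Finₚ.<-cmp j i
    ... | tri< i<j _ _ | tri< _ _ i≮j = contradiction i<j i≮j
    ... | tri< i<j _ _ | tri≈ _ _ i≮j = contradiction i<j i≮j
    ... | tri< _ _ _   | tri> _ _ _   = refl
    ... | tri≈ _ _ j≮i | tri< j<i _ _ = contradiction j<i j≮i
    ... | tri≈ _ _ _   | tri≈ _ _ _   = refl
    ... | tri≈ i≮j _ _ | tri> _ _ i<j = contradiction i<j i≮j
    ... | tri> _ _ _   | tri< _ _ _   = refl
    ... | tri> _ _ j<i | tri≈ j≮i _ _ = contradiction j<i j≮i
    ... | tri> _ _ j<i | tri> j≮i _ _ = contradiction j<i j≮i

    symmetrise-diag : ∀ i → symmetrise μ i i ≡ 0ℚ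
    symmetrise-diag i with Finₚ.<-cmp i i
    ... | tri< _ i≢i _ = contradiction refl i≢i
    ... | tri≈ _ _ _   = refl
    ... | tri> _ i≢i _ = contradiction refl i≢i

    symmetrise-nonNeg : (∀ i j → toℕ i ℕ.< toℕ j → 0ℚ ≤ μ i j) → ∀ i j → 0ℚ ≤ symmetrise μ i j
    symmetrise-nonNeg 0≤μ i j with Finₚ.<-cmp i j
    ... | tri< i<j _ _ = 0≤μ i j i<j
    ... | tri≈ _ _ _   = ≤-refl
    ... | tri> _ _ j<i = 0≤μ j i j<i

  βB-upperBound : ∀ j k → IsUpperBound (2 ℕ.+ j) (suc k) (recip (triangle (suc j)) ^ (suc k ℕ.* triangle (suc j)))
  βB-upperBound j k n μ (0≤μ , total) = begin
    βB n μ (2 ℕ.+ j) (suc k)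
      ≡⟨ βB≡∑-comb μ a (symmetrise-< μ) (2 ℕ.+ j) (suc k) ⟩
    ∑ (comb (2 ℕ.+ j) X) (λ T → cliqueWeight T ^ suc k)
      ≤⟨ ∑-^-≤ {xs = comb (2 ℕ.+ j) X} (λ {T} _ → cliqueWeight-nonNeg T) k ⟩
    ∑ (comb (2 ℕ.+ j) X) cliqueWeight ^ suc k
      ≤⟨ ^-mono-≤ (∑-nonNeg {xs = comb (2 ℕ.+ j) X} (λ {T} _ → cliqueWeight-nonNeg T))
           (∑-cliqueWeight-≤ X (trans (sym (∑-edges μ a (symmetrise-< μ))) total) j) (suc k) ⟩
    (recip (triangle (suc j)) ^ triangle (suc j)) ^ suc k
      ≡⟨ ^-* (recip (triangle (suc j))) (suc k) (triangle (suc j)) ⟨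
    recip (triangle (suc j)) ^ (suc k ℕ.* triangle (suc j)) ∎
    where
    X = allFin n
    a = symmetrise μ
    open WeightedClique a (symmetrise-nonNeg μ 0≤μ) (symmetrise-sym μ) (symmetrise-diag μ)

  -- The uniform mass on K_t attains the bound.

  module Uniform (j : ℕ) where

    uniform : Mass (2 ℕ.+ j)
    uniform _ _ = recip (triangle (suc j))

    length-K : length (pairs (allFin (2 ℕ.+ j))) ≡ triangle (suc j)
    length-K = length-pairs (suc j) (allFin (2 ℕ.+ j)) (length-tabulate (λ i → i))

    uniform-prob : IsProbMass (2 ℕ.+ j) uniform
    uniform-prob = (λ _ _ _ → recip-nonNeg (triangle (suc j))) , (begin-equality
      ∑ (edges (2 ℕ.+ j)) (λ _ → m⁻¹)                ≡⟨ ∑-edges uniform uniform (λ _ _ _ → refl) ⟩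
      ∑ (pairs (allFin (2 ℕ.+ j))) (λ _ → m⁻¹)       ≡⟨ ∑-const (pairs (allFin (2 ℕ.+ j))) m⁻¹ ⟩
      ι (length (pairs (allFin (2 ℕ.+ j)))) * m⁻¹    ≡⟨ cong (λ n → ι n * m⁻¹) length-K ⟩
      ι (triangle (suc j)) * m⁻¹                     ≡⟨ ι*recip (j ℕ.+ triangle j) ⟩
      1ℚ                                             ∎)
      where m⁻¹ = recip (triangle (suc j))

    -- On exactly t vertices the whole vertex set spans the only copy of K_t, with m edges of mass
    -- 1/m.
    βB-uniform : ∀ k → βB (2 ℕ.+ j) uniform (2 ℕ.+ j) k ≡ recip (triangle (suc j)) ^ (k ℕ.* triangle (suc j))
    βB-uniform k = begin-equality
      βB (2 ℕ.+ j) uniform (2 ℕ.+ j) k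
        ≡⟨ βB≡∑-comb uniform uniform (λ _ _ _ → refl) (2 ℕ.+ j) k ⟩
      ∑ (comb (2 ℕ.+ j) X) (λ T → ∏ (pairs T) (λ _ → m⁻¹) ^ k)
        ≡⟨ cong (λ Ts → ∑ Ts (λ T → ∏ (pairs T) (λ _ → m⁻¹) ^ k))
             (trans (cong (λ n → comb n X) (sym (length-tabulate (λ i → i)))) (comb-length≡ X)) ⟩
      ∏ (pairs X) (λ _ → m⁻¹) ^ k + 0ℚ
        ≡⟨ +-identityʳ _ ⟩
      ∏ (pairs X) (λ _ → m⁻¹) ^ k
        ≡⟨ cong (_^ k) (trans (∏-const (pairs X) m⁻¹) (cong (m⁻¹ ^_) length-K)) ⟩
      (m⁻¹ ^ triangle (suc j)) ^ k
        ≡⟨ ^-* m⁻¹ k (triangle (suc j)) ⟨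
      m⁻¹ ^ (k ℕ.* triangle (suc j)) ∎
      where
      X = allFin (2 ℕ.+ j)
      m⁻¹ = recip (triangle (suc j))

  βB-leastUpperBound : ∀ j k s → IsUpperBound (2 ℕ.+ j) k s → recip (triangle (suc j)) ^ (k ℕ.* triangle (suc j)) ≤ s
  βB-leastUpperBound j k s bound = subst (_≤ s) (βB-uniform k) (bound (2 ℕ.+ j) uniform uniform-prob)
    where open Uniform j

open import Data.Nat using (_≤_; _*_)

theorem4p8 : (t k : ℕ) → 2 ≤ t → 1 ≤ k →
    IsSupβB t k (powℚ (recip (t C 2)) (k * (t C 2)))
theorem4p8 (suc zero)    _       (ℕ.s≤s ()) _
theorem4p8 (suc (suc j)) (suc k) _ _ = subst
  (λ m → IsSupβB (2 ℕ.+ j) (suc k) (powℚ (recip m) (suc k * m))) (sym (C₂≡triangle (suc j)))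
  (CliqueBound.βB-upperBound j k , CliqueBound.βB-leastUpperBound j (suc k))
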